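{- Let $T=\{2143,2341,3412\}$. Then $$F_T(x)=\frac{1-6x+13x^2-11x^3+5x^4}{(1-x)^2(1-2x)(1-3x+x^2)}.$$
   Context: $S_n(T)$ denotes the set of permutations $\pi$ of $[n]=\{1,\dots,n\}$ (one-line notation) that avoid every pattern $\tau\in T$, i.e. no subsequence of $\pi$ is order-isomorphic to $\tau$. $F_T(x)=\sum_{n\ge 0}|S_n(T)|x^n$, a formal power series, with $|S_0(T)|=1$. -}

module Defs where

open import Data.Fin.Base as Fin using (Fin; zero; suc; toℕ)
import Data.Fin.Properties as Fin
open import Data.Fin.Permutation as Perm
  using (Permutation′; _⟨$⟩ʳ_; insert; remove; insert-remove)
open import Data.Integer.Base as ℤ using (ℤ; +_; 0ℤ; 1ℤ)
import Data.Integer.Properties as ℤ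
open import Data.Integer.Tactic.RingSolver using (solve-∀)
open import Data.List.Base as List
  using (List; []; _∷_; [_]; length; filter; allFin; cartesianProductWith)
open import Data.List.Membership.Propositional.Properties using (∈-allFin)
import Data.List.Membership.Setoid.Properties as Membership
open import Data.List.Relation.Unary.All as All using (All; []; _∷_)
open import Data.List.Relation.Unary.AllPairs using ([]; _∷_)
open import Data.List.Relation.Unary.Any using (here)
open import Data.List.Relation.Unary.Enumerates.Setoid using (IsEnumeration)
open import Data.List.Relation.Unary.Unique.Setoid using (Unique)
import Data.List.Relation.Unary.Unique.Setoid.Properties as Unique
import Data.List.Relation.Unary.Unique.Propositional.Properties as UniqueP
open import Data.Nat.Base as ℕ using (ℕ; zero; suc; _∸_)
import Data.Nat.Properties as ℕ
open import Data.Product.Base using (_×_; _,_; ∃; uncurry)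
open import Data.Vec.Base as Vec using (Vec; []; _∷_)
open import Function.Base using (_∘_)
open import Function.Bundles using (_⇔_; mk⇔; Equivalence)
open import Level using (0ℓ)
open import Relation.Binary.Bundles using (Setoid)
open import Relation.Binary.PropositionalEquality
  using (_≡_; refl; sym; trans; cong; cong₂; setoid; module ≡-Reasoning)
open import Relation.Nullary using (Dec; ¬_; ¬?)
open import Relation.Nullary.Decidable
  using (True; toWitness; map′; _×-dec_; _→-dec_)
open import Relation.Unary using (Pred; Decidable)

open import Algebra.Properties.Semiring.Sum ℤ.+-*-semiring using (sum-syntax)

-- A pattern in one-line notation.  Only the relative order of the entries
-- matters, so that 2143 is simply 2 ∷ 1 ∷ 4 ∷ 3 ∷ [].
Pattern : Set
Pattern = List ℕ

-- p lists the positions p₀ < p₁ < … of a subsequence of π order-isomorphic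
-- to τ.
Occurrence : ∀ {n} → Permutation′ n → (τ : Pattern) → Vec (Fin n) (length τ) → Set
Occurrence π τ p =
  (∀ a b → a Fin.< b → Vec.lookup p a Fin.< Vec.lookup p b) ×
  (∀ a b → (List.lookup τ a ℕ.< List.lookup τ b)
           ⇔ (π ⟨$⟩ʳ Vec.lookup p a Fin.< π ⟨$⟩ʳ Vec.lookup p b))

Contains : ∀ {n} → Permutation′ n → Pattern → Set
Contains π τ = ∃ (Occurrence π τ)

Avoids : ∀ {n} → Permutation′ n → List Pattern → Set
Avoids π T = All (λ τ → ¬ Contains π τ) T

private
  anyVec? : ∀ {n k} {P : Pred (Vec (Fin n) k) 0ℓ} → Decidable P → Dec (∃ P)
  anyVec? {k = zero}  P? = map′ ([] ,_) (λ { ([] , p) → p }) (P? [])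
  anyVec? {k = suc k} P? =
    map′ (λ (x , xs , p) → x ∷ xs , p) (λ { (x ∷ xs , p) → x , xs , p })
         (Fin.any? λ x → anyVec? λ xs → P? (x ∷ xs))

  _⇔-dec_ : ∀ {A B : Set} → Dec A → Dec B → Dec (A ⇔ B)
  a? ⇔-dec b? =
    map′ (uncurry mk⇔) (λ e → Equivalence.to e , Equivalence.from e)
         ((a? →-dec b?) ×-dec (b? →-dec a?))

occurrence? : ∀ {n} (π : Permutation′ n) τ → Decidable (Occurrence π τ)
occurrence? π τ p =
  Fin.all? (λ a → Fin.all? λ b → (a Fin.<? b) →-dec (_ Fin.<? _))
  ×-dec
  Fin.all? (λ a → Fin.all? λ b → (_ ℕ.<? _) ⇔-dec (_ Fin.<? _))

contains? : ∀ {n} (π : Permutation′ n) → Decidable (Contains π)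
contains? π τ = anyVec? (occurrence? π τ)

avoids? : ∀ {n} (T : List Pattern) → Decidable (λ (π : Permutation′ n) → Avoids π T)
avoids? T π = All.all? (λ τ → ¬? (contains? π τ)) T

-- All permutations, each listed once: the first value is chosen freely and
-- the remaining ones follow the pattern of a smaller permutation.
permutations : ∀ n → List (Permutation′ n)
permutations zero    = [ Perm.id ]
permutations (suc n) =
  cartesianProductWith (insert zero) (allFin (suc n)) (permutations n)

permutationSetoid : ℕ → Setoid 0ℓ 0ℓ
permutationSetoid n = record
  { Carrier       = Permutation′ n
  ; _≈_           = Perm._≈_
  ; isEquivalence = record
    { refl  = λ _ → refl
    ; sym   = λ p i → sym (p i)
    ; trans = λ p q i → trans (p i) (q i)
    }
  }

private
  insert-cong : ∀ {n} {i j : Fin (suc n)} {π ρ : Permutation′ n} →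
                i ≡ j → π Perm.≈ ρ → insert zero i π Perm.≈ insert zero j ρ
  insert-cong refl π≈ρ zero    = refl
  insert-cong refl π≈ρ (suc k) = cong (Fin.punchIn _) (π≈ρ k)

  insert-injective : ∀ {n} {i j : Fin (suc n)} {π ρ : Permutation′ n} →
                     insert zero i π Perm.≈ insert zero j ρ → i ≡ j × π Perm.≈ ρ
  insert-injective {i = i} eq with refl ← eq zero =
    refl , λ k → Fin.punchIn-injective i _ _ (eq (suc k))

permutations-complete : ∀ n → IsEnumeration (permutationSetoid n) (permutations n)
permutations-complete zero    π = here λ ()
permutations-complete (suc n) π =
  Membership.∈-resp-≈ (permutationSetoid (suc n))
    {x = insert zero (π ⟨$⟩ʳ zero) (remove zero π)} {y = π} (insert-remove zero π)
    (Membership.∈-cartesianProductWith⁺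
      (setoid (Fin (suc n))) (permutationSetoid n) (permutationSetoid (suc n))
      (insert-cong {n})
      (∈-allFin (π ⟨$⟩ʳ zero))
      (permutations-complete n (remove zero π)))

permutations-unique : ∀ n → Unique (permutationSetoid n) (permutations n)
permutations-unique zero    = [] ∷ []
permutations-unique (suc n) =
  Unique.cartesianProductWith⁺
    (setoid (Fin (suc n))) (permutationSetoid n) (permutationSetoid (suc n))
    (insert zero) insert-injective (UniqueP.allFin⁺ (suc n)) (permutations-unique n)

S : (n : ℕ) → List Pattern → List (Permutation′ n)
S n T = filter (avoids? T) (permutations n)

-- The formal power series ∑ₙ (f n) xⁿ over ℤ.
Series : Set
Series = ℕ → ℤ

infix 4 _≈_
_≈_ : Series → Series → Set
f ≈ g = ∀ n → f n ≡ g n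

polynomial : List ℤ → Series
polynomial []       n       = 0ℤ
polynomial (a ∷ as) zero    = a
polynomial (a ∷ as) (suc n) = polynomial as n

infixl 7 _*_ _/_
infixr 8 _^_

_*_ : Series → Series → Series
(f * g) n = ∑[ i < suc n ] (f (toℕ i) ℤ.* g (n ∸ toℕ i))

_^_ : Series → ℕ → Series
f ^ zero  = polynomial [ 1ℤ ]
f ^ suc k = f * f ^ k

-- Long division by a series d with constant term 1: the constant term of
-- the quotient is that of the dividend a, and the shift of the quotient is
-- the quotient of the remainder (a - a 0 · d) / x.
remainder : Series → Series → Series
remainder a d n = a (suc n) ℤ.- a 0 ℤ.* d (suc n)

longDivision : Series → Series → Series
longDivision a d zero    = a 0
longDivision a d (suc n) = longDivision (remainder a d) d n

_/_ : (a d : Series) {_ : True (d 0 ℤ.≟ 1ℤ)} → Series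
a / d = longDivision a d

/-*-cancel : ∀ a d {d₀ : True (d 0 ℤ.≟ 1ℤ)} → (a / d) {d₀} * d ≈ a
/-*-cancel a d {d₀} zero = begin
  a 0 ℤ.* d 0 ℤ.+ 0ℤ  ≡⟨ cong (λ z → a 0 ℤ.* z ℤ.+ 0ℤ) (toWitness d₀) ⟩
  a 0 ℤ.* 1ℤ ℤ.+ 0ℤ   ≡⟨ unit (a 0) ⟩
  a 0                 ∎
  where
  open ≡-Reasoning
  unit : ∀ x → x ℤ.* 1ℤ ℤ.+ 0ℤ ≡ x
  unit = solve-∀
/-*-cancel a d {d₀} (suc n) = begin
  a 0 ℤ.* d (suc n) ℤ.+ (longDivision (remainder a d) d * d) n
    ≡⟨ cong (λ z → a 0 ℤ.* d (suc n) ℤ.+ z) (/-*-cancel (remainder a d) d {d₀} n) ⟩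
  a 0 ℤ.* d (suc n) ℤ.+ remainder a d n
    ≡⟨ cancel (a 0 ℤ.* d (suc n)) (a (suc n)) ⟩
  a (suc n) ∎
  where
  open ≡-Reasoning
  cancel : ∀ x y → x ℤ.+ (y ℤ.- x) ≡ y
  cancel = solve-∀

/-unique : ∀ q a d {d₀ : True (d 0 ℤ.≟ 1ℤ)} → q * d ≈ a → q ≈ (a / d) {d₀}
/-unique q a d {d₀} qd≈a = λ { zero → q₀≡a₀ ; (suc n) → /-unique (q ∘ suc) (remainder a d) d {d₀} rest n }
  where
  open ≡-Reasoning
  unit : ∀ x → x ≡ x ℤ.* 1ℤ ℤ.+ 0ℤ
  unit = solve-∀
  cancel : ∀ x y → y ≡ (x ℤ.+ y) ℤ.- x
  cancel = solve-∀
  q₀≡a₀ : q 0 ≡ a 0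
  q₀≡a₀ = begin
    q 0                 ≡⟨ unit (q 0) ⟩
    q 0 ℤ.* 1ℤ ℤ.+ 0ℤ   ≡⟨ cong (λ z → q 0 ℤ.* z ℤ.+ 0ℤ) (toWitness d₀) ⟨
    q 0 ℤ.* d 0 ℤ.+ 0ℤ  ≡⟨ qd≈a 0 ⟩
    a 0                 ∎
  rest : (q ∘ suc) * d ≈ remainder a d
  rest n = begin
    ((q ∘ suc) * d) n
      ≡⟨ cancel (q 0 ℤ.* d (suc n)) _ ⟩
    (q * d) (suc n) ℤ.- q 0 ℤ.* d (suc n)
      ≡⟨ cong₂ (λ x y → x ℤ.- y ℤ.* d (suc n)) (qd≈a (suc n)) q₀≡a₀ ⟩
    a (suc n) ℤ.- a 0 ℤ.* d (suc n) ∎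

F : List Pattern → Series
F T n = + length (S n T)

{-# OPTIONS --safe #-}
-- Reading a permutation backwards turns the patterns into 1432, 2143 and 3412.
-- Such permutations are generated by prepending a value, that is, by choosing
-- a gap between the values already present, and the gaps that remain usable
-- after a choice depend only on three data: whether an ascent lies below a
-- gap, whether a descent lies above it, and which pairs of gaps enclose a
-- descent.  This leaves four families of nodes of the generating tree, with k
-- (or r + const) usable gaps, and the succession rules
--   A r → A (r+1), B r, C 3, …, C (r+2)
--   B r → D (r+1), B (r+1), B r, C 3, …, C (r+2)
--   C k → C 1, …, C k
--   D r → D r, C (r+2), C 1, …, C r
-- They are solved by iterated partial sums of two linear recurrent sequences,
-- which gives |Sₙ(T)| = φₙ + 2n + 1 - 3·2ⁿ with φₙ₊₂ = 3φₙ₊₁ - φₙ.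
module Submission where

open import Defs
open import Data.List.Base using ([]; _∷_)

open import Data.Bool.Base using (Bool; true; false; not; _∧_; _∨_; T; if_then_else_)
open import Data.Bool.Properties
  using (T?; T-∧; T-∨; ∧-zeroʳ; ∧-identityʳ; ∧-assoc; ∨-zeroʳ; ∨-identityʳ)
open import Data.Fin.Base as Fin using (Fin; zero; suc; toℕ; opposite)
open import Data.Fin.Patterns using (0F; 1F; 2F; 3F)
import Data.Fin.Properties as Fin
open import Data.Fin.Permutation as Perm using (Permutation′; _⟨$⟩ʳ_; _∘ₚ_; insert)
open import Data.Integer.Base as ℤ using (0ℤ)
import Data.Integer.Properties as ℤ
open import Data.Integer.Tactic.RingSolver using (solve-∀)
open import Data.List.Base as List
  using (List; [_]; _++_; map; filter; filterᵇ; upTo; applyUpTo; allFin; tabulate;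
         cartesianProductWith; length)
open import Data.List.Membership.Propositional using (_∈_)
open import Data.List.Membership.Propositional.Properties using (∈-map⁺; ∈-map⁻; ∈-++⁺ʳ)
open import Data.List.Membership.Propositional.Properties.WithK using (unique∧set⇒bag)
import Data.List.Membership.Setoid.Properties as Membership
open import Data.List.Properties
  using (filter-++; filter-≐; ++-assoc; ++-identityʳ; ∷-injective; length-++; length-map;
         map-++; map-∘; map-cong; map-applyUpTo; map-tabulate; tabulate-cong; upTo-∷ʳ)
open import Data.List.Relation.Binary.BagAndSetEquality using (∼bag⇒↭)
open import Data.List.Relation.Binary.Permutation.Propositional using (_↭_)
open import Data.List.Relation.Binary.Permutation.Propositional.Properties
  using (filter-↭; ↭-length)
open import Data.List.Relation.Unary.All as All using (All; []; _∷_)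
import Data.List.Relation.Unary.All.Properties as All
open import Data.List.Relation.Unary.AllPairs using (AllPairs; []; _∷_)
import Data.List.Relation.Unary.AllPairs.Properties as AllPairs
open import Data.List.Relation.Unary.Any using (here; there)
import Data.List.Relation.Unary.Unique.Setoid.Properties as Unique
open import Data.Nat.Base as ℕ using (ℕ; zero; suc; _+_; _≤_; _<_; _<ᵇ_; z≤n; s≤s; s≤s⁻¹)
open import Data.Nat.ListAction using (sum)
open import Data.Nat.ListAction.Properties using (sum-++)
open import Data.Nat.Properties as ℕ using (<ᵇ⇒<; <⇒<ᵇ)
import Data.Nat.Tactic.RingSolver as ℕSolver
open import Data.Product.Base using (_×_; _,_; proj₁; proj₂; ∃-syntax)
open import Data.Sum.Base using (inj₁; inj₂; [_,_]′)
open import Data.Vec.Base as Vec using (Vec; []; _∷_; lookup)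
import Data.Vec.Properties as Vec
open import Function.Base using (_∘_; id)
open import Function.Bundles using (_⇔_; mk⇔; Equivalence)
open import Relation.Binary.Definitions using (tri<; tri≈; tri>)
open import Relation.Binary.PropositionalEquality
  using (_≡_; _≗_; refl; sym; trans; cong; cong₂; subst; subst₂; setoid; module ≡-Reasoning)
open import Relation.Nullary using (¬_; yes; no; contradiction)

open Equivalence using (to; from)
open ≡-Reasoning

-- Four families suffice because every value below `n` occurs. Inserting at `g` puts a descent above
-- each lower gap and an ascent below each strictly higher one, so every surviving gap other than
-- the two copies of `g` can survive later insertions from one side only. The number of usable gaps
-- is still no invariant: it also matters which low gaps are separated by a descent from which
-- insertion points, and this distinguishes B and D from C.
--
-- In the counting, the rules for A and B lack the children `C 1` and `C 2`. The same correction
-- `offset` repairs both, since each rule has exactly two children that again carry the correction.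
-- After a shift of the index by 2, all terms obey Pascal's rule, so the recurrences need to hold
-- only in a virtual column 0. That column is a linear recurrence with matrix (1 1; 1 2), the source
-- of `1 - 3x + x²`. The power of 2 comes in equal halves from `offset` and from the column of A.

private variable
  A B C : Set

-- Patterns in sequences of values

<ᵇ-true : ∀ {m n} → m < n → (m <ᵇ n) ≡ true
<ᵇ-true {m} {n} m<n with m <ᵇ n | <⇒<ᵇ m<n
... | true | _ = refl

<ᵇ-false : ∀ {m n} → n ≤ m → (m <ᵇ n) ≡ false
<ᵇ-false {m} {n} n≤m with m <ᵇ n in eq
... | false = refl
... | true  = contradiction (ℕ.≤-trans (<ᵇ⇒< m n (subst T (sym eq) _)) n≤m) (ℕ.<-irrefl refl)

-- Quantifies over the subsequences of length `k`. With Boolean values, the effect of a prepended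
-- entry becomes an equation that can be used under the filters defining `gaps`.
some : ∀ k → (Vec ℕ k → Bool) → List ℕ → Bool
some zero    P xs       = P []
some (suc k) P []       = false
some (suc k) P (x ∷ xs) = some k (P ∘ (x ∷_)) xs ∨ some (suc k) P xs

some-cong : ∀ k {P Q} → (∀ v → P v ≡ Q v) → ∀ xs → some k P xs ≡ some k Q xs
some-cong zero    P≗Q xs       = P≗Q []
some-cong (suc k) P≗Q []       = refl
some-cong (suc k) P≗Q (x ∷ xs) =
  cong₂ _∨_ (some-cong k (P≗Q ∘ (x ∷_)) xs) (some-cong (suc k) P≗Q xs)

some-map : ∀ k P (f : ℕ → ℕ) xs → some k P (map f xs) ≡ some k (P ∘ Vec.map f) xs
some-map zero    P f xs       = refl
some-map (suc k) P f []       = refl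
some-map (suc k) P f (x ∷ xs) =
  cong₂ _∨_ (some-map k (P ∘ (f x ∷_)) f xs) (some-map (suc k) P f xs)

some-none : ∀ k {P} → (∀ v → P v ≡ false) → ∀ xs → some k P xs ≡ false
some-none zero    none xs       = none []
some-none (suc k) none []       = refl
some-none (suc k) none (x ∷ xs) =
  cong₂ _∨_ (some-none k (none ∘ (x ∷_)) xs) (some-none (suc k) none xs)

∨-interchange : ∀ a b c d → (a ∨ b) ∨ (c ∨ d) ≡ (a ∨ c) ∨ (b ∨ d)
∨-interchange false b false d = refl
∨-interchange false false true d = refl
∨-interchange false true true d = refl
∨-interchange true b c d = refl

some-∨ : ∀ k P Q xs → some k (λ v → P v ∨ Q v) xs ≡ some k P xs ∨ some k Q xs
some-∨ zero    P Q xs       = refl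
some-∨ (suc k) P Q []       = refl
some-∨ (suc k) P Q (x ∷ xs) = trans
  (cong₂ _∨_ (some-∨ k (P ∘ (x ∷_)) (Q ∘ (x ∷_)) xs) (some-∨ (suc k) P Q xs))
  (∨-interchange (some k (P ∘ (x ∷_)) xs) (some k (Q ∘ (x ∷_)) xs) _ _)

some₁-∈ : ∀ {P x xs} → x ∈ xs → P (x ∷ []) ≡ true → some 1 P xs ≡ true
some₁-∈ {P} {x} {_ ∷ xs} (here refl) Px = cong (_∨ some 1 P xs) Px
some₁-∈ {P} {xs = y ∷ _} (there x∈) Px
  with P (y ∷ [])
... | true  = refl
... | false = some₁-∈ x∈ Px

-- Prepending a value

bump : ℕ → ℕ → ℕ
bump zero    x       = suc x
bump (suc g) zero    = zero
bump (suc g) (suc x) = suc (bump g x)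

infixr 5 _▹_
-- `bump g` is the order embedding whose image misses exactly `g`, so the old entries keep their
-- relative order and gap `g` becomes the new first value.
_▹_ : ℕ → List ℕ → List ℕ
g ▹ xs = g ∷ map (bump g) xs

bump-<-bump : ∀ g x y → (bump g x <ᵇ bump g y) ≡ (x <ᵇ y)
bump-<-bump zero    x       y       = refl
bump-<-bump (suc g) zero    zero    = refl
bump-<-bump (suc g) zero    (suc y) = refl
bump-<-bump (suc g) (suc x) zero    = refl
bump-<-bump (suc g) (suc x) (suc y) = bump-<-bump g x y

bump-<-lower : ∀ {g h} x → h ≤ g → (bump g x <ᵇ h) ≡ (x <ᵇ h)
bump-<-lower {zero}  x       z≤n       = refl
bump-<-lower {suc g} zero    z≤n       = refl
bump-<-lower {suc g} (suc x) z≤n       = refl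
bump-<-lower {suc g} zero    (s≤s h≤g) = refl
bump-<-lower {suc g} (suc x) (s≤s h≤g) = bump-<-lower x h≤g

bump-<-upper : ∀ {g h} x → g ≤ h → (bump g x <ᵇ suc h) ≡ (x <ᵇ h)
bump-<-upper         x       z≤n       = refl
bump-<-upper         zero    (s≤s g≤h) = refl
bump-<-upper         (suc x) (s≤s g≤h) = bump-<-upper x g≤h

<-bump : ∀ g x → (g <ᵇ bump g x) ≡ not (x <ᵇ g)
<-bump zero    x       = refl
<-bump (suc g) zero    = refl
<-bump (suc g) (suc x) = <-bump g x

-- Gap h separates the values < h from the values ≥ h.  There may be an ascent
-- below it (asc), a descent above it (des), or a descent between two gaps
-- (inv); a gap is bad if a value prepended there starts a forbidden pattern.
betweenᵖ : ℕ → ℕ → Vec ℕ 1 → Bool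
betweenᵖ h k (a ∷ []) = not (a <ᵇ h) ∧ (a <ᵇ k)

ascᵖ : ℕ → Vec ℕ 2 → Bool
ascᵖ h (a ∷ b ∷ []) = (a <ᵇ b) ∧ (b <ᵇ h)

desᵖ : ℕ → Vec ℕ 2 → Bool
desᵖ h (a ∷ b ∷ []) = not (b <ᵇ h) ∧ (b <ᵇ a)

invᵖ : ℕ → ℕ → Vec ℕ 2 → Bool
invᵖ h k (a ∷ b ∷ []) = not (b <ᵇ h) ∧ (b <ᵇ a) ∧ (a <ᵇ k)

-- One disjunct each for 1432, 2143 and 3412: the last three letters of the pattern, with the gap
-- `h` in the place of the first.
badᵖ : ℕ → Vec ℕ 3 → Bool
badᵖ h (a ∷ b ∷ c ∷ []) =
  (not (c <ᵇ h) ∧ (c <ᵇ b) ∧ (b <ᵇ a)) ∨ ((a <ᵇ h) ∧ not (c <ᵇ h) ∧ (c <ᵇ b)) ∨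
  (not (a <ᵇ h) ∧ (b <ᵇ c) ∧ (c <ᵇ h))

fullᵖ : Vec ℕ 4 → Bool
fullᵖ (a ∷ b ∷ c ∷ d ∷ []) =
  ((a <ᵇ d) ∧ (d <ᵇ c) ∧ (c <ᵇ b)) ∨ ((b <ᵇ a) ∧ (a <ᵇ d) ∧ (d <ᵇ c)) ∨
  ((a <ᵇ b) ∧ (c <ᵇ d) ∧ (d <ᵇ a))

between : ℕ → ℕ → List ℕ → Bool
between h k = some 1 (betweenᵖ h k)

asc des bad : ℕ → List ℕ → Bool
asc h = some 2 (ascᵖ h)
des h = some 2 (desᵖ h)
bad h = some 3 (badᵖ h)

inv : ℕ → ℕ → List ℕ → Bool
inv h k = some 2 (invᵖ h k)

full : List ℕ → Bool
full = some 4 fullᵖ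

-- A subsequence either starts with the new entry, leaving the condition `Q` on the rest, or avoids
-- it and lies in the old entries.
some-▹ : ∀ k {P g Q R} →
         (∀ v → P (g ∷ Vec.map (bump g) v) ≡ Q v) →
         (∀ v → P (Vec.map (bump g) v) ≡ R v) →
         ∀ xs → some (suc k) P (g ▹ xs) ≡ some k Q xs ∨ some (suc k) R xs
some-▹ k {P} {g} PQ PR xs = cong₂ _∨_
  (trans (some-map k (P ∘ (g ∷_)) (bump g) xs) (some-cong k PQ xs))
  (trans (some-map (suc k) P (bump g) xs) (some-cong (suc k) PR xs))

some-▹-skip : ∀ k {P g R} →
         (∀ v → P (g ∷ Vec.map (bump g) v) ≡ false) →
         (∀ v → P (Vec.map (bump g) v) ≡ R v) →
         ∀ xs → some (suc k) P (g ▹ xs) ≡ some (suc k) R xs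
some-▹-skip k {R = R} PF PR xs = trans (some-▹ k PF PR xs)
  (cong (_∨ some (suc k) R xs) (some-none k (λ _ → refl) xs))

between-empty : ∀ {h k} → k ≤ h → ∀ b → not (b <ᵇ h) ∧ (b <ᵇ k) ≡ false
between-empty {h} {k} k≤h b with b ℕ.<? h
... | yes b<h rewrite <ᵇ-true b<h = refl
... | no  b≮h rewrite <ᵇ-false (ℕ.≮⇒≥ b≮h) = <ᵇ-false (ℕ.≤-trans k≤h (ℕ.≮⇒≥ b≮h))

-- Prepending at gap g splits this gap: h ≤ g keeps its index, and h ≥ g becomes
-- suc h.
asc-lower : ∀ {g h} → h ≤ g → ∀ xs → asc h (g ▹ xs) ≡ asc h xs
asc-lower {g} {h} h≤g = some-▹-skip 1
  (λ { (b ∷ []) → trans (cong₂ _∧_ (<-bump g b) (bump-<-lower b h≤g)) (between-empty h≤g b) })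
  (λ { (a ∷ b ∷ []) → cong₂ _∧_ (bump-<-bump g a b) (bump-<-lower b h≤g) })

asc-upper : ∀ {g h} → g ≤ h → ∀ xs → asc (suc h) (g ▹ xs) ≡ between g h xs ∨ asc h xs
asc-upper {g} {h} g≤h = some-▹ 1
  (λ { (b ∷ []) → cong₂ _∧_ (<-bump g b) (bump-<-upper b g≤h) })
  (λ { (a ∷ b ∷ []) → cong₂ _∧_ (bump-<-bump g a b) (bump-<-upper b g≤h) })

des-lower : ∀ {g h} → h ≤ g → ∀ xs → des h (g ▹ xs) ≡ between h g xs ∨ des h xs
des-lower {g} {h} h≤g = some-▹ 1
  (λ { (b ∷ []) → cong₂ (λ u v → not u ∧ v) (bump-<-lower b h≤g) (bump-<-lower {g} b ℕ.≤-refl) })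
  (λ { (a ∷ b ∷ []) → cong₂ (λ u v → not u ∧ v) (bump-<-lower b h≤g) (bump-<-bump g b a) })

des-upper : ∀ {g h} → g ≤ h → ∀ xs → des (suc h) (g ▹ xs) ≡ des h xs
des-upper {g} {h} g≤h = some-▹-skip 1
  (λ { (b ∷ []) → trans
    (cong₂ (λ u v → not u ∧ v) (bump-<-upper b g≤h) (bump-<-lower {g} b ℕ.≤-refl))
    (between-empty g≤h b) })
  (λ { (a ∷ b ∷ []) → cong₂ (λ u v → not u ∧ v) (bump-<-upper b g≤h) (bump-<-bump g b a) })

inv-cong : ∀ {a a′ b b′ c c′} → a ≡ a′ → b ≡ b′ → c ≡ c′ → not a ∧ b ∧ c ≡ not a′ ∧ b′ ∧ c′
inv-cong refl refl refl = refl

inv-lower : ∀ {g h k} → h ≤ g → k ≤ g → ∀ xs → inv h k (g ▹ xs) ≡ inv h k xs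
inv-lower {g} {h} {k} h≤g k≤g = some-▹-skip 1
  (λ { (b ∷ []) → trans (cong (λ z → not (bump g b <ᵇ h) ∧ (bump g b <ᵇ g) ∧ z) (<ᵇ-false k≤g))
     (trans (cong (not (bump g b <ᵇ h) ∧_) (∧-zeroʳ (bump g b <ᵇ g))) (∧-zeroʳ _)) })
  (λ { (a ∷ b ∷ []) → inv-cong (bump-<-lower b h≤g) (bump-<-bump g b a) (bump-<-lower a k≤g) })

inv-across : ∀ {g h k} → h ≤ g → g ≤ k → ∀ xs →
             inv h (suc k) (g ▹ xs) ≡ between h g xs ∨ inv h k xs
inv-across {g} {h} {k} h≤g g≤k = some-▹ 1
  (λ { (b ∷ []) → trans
    (inv-cong (bump-<-lower b h≤g) (bump-<-lower {g} b ℕ.≤-refl) (<ᵇ-true (s≤s g≤k)))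
    (cong (not (b <ᵇ h) ∧_) (∧-identityʳ _)) })
  (λ { (a ∷ b ∷ []) → inv-cong (bump-<-lower b h≤g) (bump-<-bump g b a) (bump-<-upper a g≤k) })

inv-upper : ∀ {g h k} → g ≤ h → g ≤ k → ∀ xs → inv (suc h) (suc k) (g ▹ xs) ≡ inv h k xs
inv-upper {g} {h} {k} g≤h g≤k = some-▹-skip 1
  (λ { (b ∷ []) → trans
    (inv-cong (bump-<-upper b g≤h) (bump-<-lower {g} b ℕ.≤-refl) refl)
    (trans (sym (∧-assoc (not (b <ᵇ h)) (b <ᵇ g) _)) (cong (_∧ _) (between-empty g≤h b))) })
  (λ { (a ∷ b ∷ []) → inv-cong (bump-<-upper b g≤h) (bump-<-bump g b a) (bump-<-upper a g≤k) })

inv-refl : ∀ h xs → inv h h xs ≡ false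
inv-refl h = some-none 2 λ { (a ∷ b ∷ []) → lemma a b }
  where
  lemma : ∀ a b → not (b <ᵇ h) ∧ (b <ᵇ a) ∧ (a <ᵇ h) ≡ false
  lemma a b with b ℕ.<? a
  ... | no b≮a rewrite <ᵇ-false (ℕ.≮⇒≥ b≮a) = ∧-zeroʳ _
  ... | yes b<a with b ℕ.<? h
  ... | yes b<h rewrite <ᵇ-true b<h = refl
  ... | no  b≮h rewrite <ᵇ-false {a} {h} (ℕ.≤-trans (ℕ.≮⇒≥ b≮h) (ℕ.<⇒≤ b<a)) =
    trans (cong (not (b <ᵇ h) ∧_) (∧-zeroʳ (b <ᵇ a))) (∧-zeroʳ _)

bad-cong : ∀ {a a′ b b′ c c′ d d′ e e′} → a ≡ a′ → b ≡ b′ → c ≡ c′ → d ≡ d′ → e ≡ e′ →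
  (not a ∧ b ∧ c) ∨ (d ∧ not a ∧ b) ∨ (not d ∧ e ∧ a) ≡
  (not a′ ∧ b′ ∧ c′) ∨ (d′ ∧ not a′ ∧ b′) ∨ (not d′ ∧ e′ ∧ a′)
bad-cong refl refl refl refl refl = refl

-- A new entry above the gap cannot be the 1 of 2143. It can be the 4 of 1432, which needs a descent
-- between `h` and `g`, or the 4 of 3412, which needs an ascent below `h`.
bad-lower : ∀ {g h} → h ≤ g → ∀ xs →
            bad h (g ▹ xs) ≡ (inv h g xs ∨ asc h xs) ∨ bad h xs
bad-lower {g} {h} h≤g xs = trans
  (some-▹ 2 {Q = λ v → invᵖ h g v ∨ ascᵖ h v}
    (λ { (b ∷ c ∷ []) → bad-cong (bump-<-lower c h≤g) (bump-<-bump g c b)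
                          (bump-<-lower {g} b ℕ.≤-refl) (<ᵇ-false h≤g) (bump-<-bump g b c) })
    (λ { (a ∷ b ∷ c ∷ []) → bad-cong (bump-<-lower c h≤g) (bump-<-bump g c b)
                          (bump-<-bump g b a) (bump-<-lower a h≤g) (bump-<-bump g b c) })
    xs)
  (cong (_∨ bad h xs)
    (some-∨ 2 (invᵖ h g) (ascᵖ h) xs))

-- A new entry below the gap serves as the 1 of 2143 for any descent above the gap. The disjunct of
-- 1432 also asks for such a descent and is absorbed.
bad-upper : ∀ {g h} → g ≤ h → ∀ xs → bad (suc h) (g ▹ xs) ≡ des h xs ∨ bad h xs
bad-upper {g} {h} g≤h = some-▹ 2
    (λ { (b ∷ c ∷ []) → trans (bad-cong (bump-<-upper c g≤h) (bump-<-bump g c b)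
                          refl (<ᵇ-true (s≤s g≤h)) refl)
                          (absorb (not (c <ᵇ h)) (c <ᵇ b) _) })
    (λ { (a ∷ b ∷ c ∷ []) → bad-cong (bump-<-upper c g≤h) (bump-<-bump g c b)
                          (bump-<-bump g b a) (bump-<-upper a g≤h) (bump-<-bump g b c) })
  where
  absorb : ∀ x y z → (x ∧ y ∧ z) ∨ (x ∧ y) ∨ false ≡ x ∧ y
  absorb false y     z     = refl
  absorb true  false z     = refl
  absorb true  true  false = refl
  absorb true  true  true  = refl

full-▹ : ∀ g xs → full (g ▹ xs) ≡ bad g xs ∨ full xs
full-▹ g = some-▹ 3
  (λ { (b ∷ c ∷ d ∷ []) → head b c d })
  (λ { (a ∷ b ∷ c ∷ d ∷ []) → tail a b c d })
  where
  head : ∀ b c d → fullᵖ (g ∷ bump g b ∷ bump g c ∷ bump g d ∷ []) ≡ badᵖ g (b ∷ c ∷ d ∷ [])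
  head b c d rewrite <-bump g d | <-bump g b | bump-<-bump g d c | bump-<-bump g c b
    | bump-<-bump g c d | bump-<-lower {g} b ℕ.≤-refl | bump-<-lower {g} d ℕ.≤-refl = refl
  tail : ∀ a b c d → fullᵖ (Vec.map (bump g) (a ∷ b ∷ c ∷ d ∷ [])) ≡ fullᵖ (a ∷ b ∷ c ∷ d ∷ [])
  tail a b c d rewrite bump-<-bump g a d | bump-<-bump g d c | bump-<-bump g c b
    | bump-<-bump g b a | bump-<-bump g a b | bump-<-bump g c d | bump-<-bump g d a = refl

-- Guarantees that two distinct gaps are always separated by a value, so that `between` is decided
-- by comparing the gaps alone.
Complete : ℕ → List ℕ → Set
Complete n xs = ∀ {v} → v < n → v ∈ xs

bump-< : ∀ {g v} → v < g → bump g v ≡ v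
bump-< {v = zero}  (s≤s _)   = refl
bump-< {v = suc v} (s≤s v<g) = cong suc (bump-< v<g)

bump-≥ : ∀ {g v} → g ≤ v → bump g v ≡ suc v
bump-≥ z≤n       = refl
bump-≥ (s≤s g≤v) = cong suc (bump-≥ g≤v)

▹-complete : ∀ {n g xs} → g ≤ n → Complete n xs → Complete (suc n) (g ▹ xs)
▹-complete {n} {g} {xs} g≤n all {v} v<1+n with ℕ.<-cmp v g
... | tri< v<g _ _ = there (subst (_∈ _) (bump-< v<g) (∈-map⁺ (bump g) (all (ℕ.≤-trans v<g g≤n))))
... | tri≈ _ refl _ = here refl
▹-complete g≤n all {suc v} (s≤s v<n) | tri> _ _ (s≤s g≤v) =
  there (subst (_∈ _) (bump-≥ g≤v) (∈-map⁺ (bump _) (all v<n)))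

between-complete : ∀ {n g h xs} → Complete n xs → h ≤ n → g < h → between g h xs ≡ true
between-complete {g = g} all h≤n g<h =
  some₁-∈ (all (ℕ.≤-trans g<h h≤n)) (cong₂ (λ u v → not u ∧ v) (<ᵇ-false (ℕ.≤-refl {g})) (<ᵇ-true g<h))

between-refl : ∀ g xs → between g g xs ≡ false
between-refl g = some-none 1 λ { (b ∷ []) → between-empty (ℕ.≤-refl {g}) b }

-- The gaps of a sequence

filterᵇ-cong : ∀ (p q : A → Bool) {xs} → All (λ x → p x ≡ q x) xs → filterᵇ p xs ≡ filterᵇ q xs
filterᵇ-cong p q [] = refl
filterᵇ-cong p q {x ∷ xs} (px≡qx ∷ eqs) with p x | q x | px≡qx
... | true  | _ | refl = cong (x ∷_) (filterᵇ-cong p q eqs)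
... | false | _ | refl = filterᵇ-cong p q eqs

filterᵇ-∨ : ∀ (p q : A → Bool) xs →
  filterᵇ (λ x → not (p x ∨ q x)) xs ≡ filterᵇ (not ∘ p) (filterᵇ (not ∘ q) xs)
filterᵇ-∨ p q [] = refl
filterᵇ-∨ p q (x ∷ xs) with q x | p x in px
... | false | false rewrite px = cong (x ∷_) (filterᵇ-∨ p q xs)
... | false | true  rewrite px = filterᵇ-∨ p q xs
... | true  | false = filterᵇ-∨ p q xs
... | true  | true  = filterᵇ-∨ p q xs

filterᵇ-map : ∀ {B : Set} (p : B → Bool) (f : A → B) xs →
  filterᵇ p (map f xs) ≡ map f (filterᵇ (p ∘ f) xs)
filterᵇ-map p f [] = refl
filterᵇ-map p f (x ∷ xs) with p (f x)
... | true  = cong (f x ∷_) (filterᵇ-map p f xs)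
... | false = filterᵇ-map p f xs

filterᵇ-++ : ∀ (p : A → Bool) xs ys → filterᵇ p (xs ++ ys) ≡ filterᵇ p xs ++ filterᵇ p ys
filterᵇ-++ p = filter-++ (T? ∘ p)

filterᵇ-accept : ∀ {p : A → Bool} {x} → p x ≡ true → ∀ xs → filterᵇ p (x ∷ xs) ≡ x ∷ filterᵇ p xs
filterᵇ-accept {p = p} {x} px xs rewrite px = refl

filterᵇ-reject : ∀ {p : A → Bool} {x} → p x ≡ false → ∀ xs → filterᵇ p (x ∷ xs) ≡ filterᵇ p xs
filterᵇ-reject {p = p} {x} px xs rewrite px = refl

filterᵇ-all : ∀ {p : A → Bool} {xs} → All (λ x → p x ≡ true) xs → filterᵇ p xs ≡ xs
filterᵇ-all []        = refl
filterᵇ-all {p = p} {x ∷ xs} (px ∷ ps) = trans (filterᵇ-accept {p = p} px xs) (cong (x ∷_) (filterᵇ-all ps))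

filterᵇ-none : ∀ {p : A → Bool} {xs} → All (λ x → p x ≡ false) xs → filterᵇ p xs ≡ []
filterᵇ-none []        = refl
filterᵇ-none {p = p} {x ∷ xs} (px ∷ ps) = trans (filterᵇ-reject {p = p} px xs) (filterᵇ-none ps)

applyUpTo-+ : ∀ (f : ℕ → A) m n → applyUpTo f (m + n) ≡ applyUpTo f m ++ applyUpTo (f ∘ (m +_)) n
applyUpTo-+ f zero    n = refl
applyUpTo-+ f (suc m) n = cong (f 0 ∷_) (applyUpTo-+ (f ∘ ℕ.suc) m n)

split-unique : ∀ {g} {as bs ls us : List ℕ} → All (_< g) as → All (_< g) ls →
               as ++ g ∷ bs ≡ ls ++ g ∷ us → as ≡ ls × bs ≡ us
split-unique [] [] refl = refl , refl
split-unique [] (g<g ∷ _) refl = contradiction g<g (ℕ.<-irrefl refl)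
split-unique (g<g ∷ _) [] refl = contradiction g<g (ℕ.<-irrefl refl)
split-unique (_ ∷ as<g) (_ ∷ ls<g) eq with refl , eq′ ← ∷-injective eq
  with refl , refl ← split-unique as<g ls<g eq′ = refl , refl

AllPairs-split : ∀ {R : ℕ → ℕ → Set} {g} ls {us} → AllPairs R (ls ++ g ∷ us) →
                 All (λ h → R h g) ls × All (R g) us
AllPairs-split []       (gu ∷ _)  = [] , gu
AllPairs-split (x ∷ ls) (xs ∷ ps) with _ , xg ∷ _ ← All.++⁻ ls xs
  with lg , gu ← AllPairs-split ls ps = xg ∷ lg , gu

good : List ℕ → ℕ → Bool
good xs h = not (bad h xs)

gaps : ℕ → List ℕ → List ℕ
gaps n xs = filterᵇ (good xs) (upTo (suc n))

gaps-< : ∀ n xs → AllPairs _<_ (gaps n xs)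
gaps-< n xs = AllPairs.filter⁺ (T? ∘ good xs) (AllPairs.applyUpTo⁺₁ id (suc n) (λ i<j _ → i<j))

gaps-≤ : ∀ n xs → All (_≤ n) (gaps n xs)
gaps-≤ n xs = All.filter⁺ (T? ∘ good xs) (All.applyUpTo⁺₁ id (suc n) s≤s⁻¹)

gaps-good : ∀ n xs → All (λ h → bad h xs ≡ false) (gaps n xs)
gaps-good n xs = All.map (λ {h} → lemma (bad h xs)) (All.all-filter (T? ∘ good xs) (upTo (suc n)))
  where
  lemma : ∀ b → T (not b) → b ≡ false
  lemma false _ = refl

keep : ℕ → List ℕ → ℕ → Bool
keep g xs h = not (inv h g xs ∨ asc h xs)

-- A bad gap stays bad, so the new gaps are found by filtering the old ones. Gap `g` appears in both
-- halves, because its lower copy `g` and its upper copy `suc g` are tested separately.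
gaps-▹ : ∀ {n xs} ls {g us} → gaps n xs ≡ ls ++ g ∷ us →
         gaps (suc n) (g ▹ xs) ≡
         filterᵇ (keep g xs) (ls ++ [ g ]) ++ map suc (filterᵇ (λ h → not (des h xs)) (g ∷ us))
gaps-▹ {n} {xs} ls {g} {us} eq with _ , g≤n ∷ _ ← All.++⁻ ls (subst (All (_≤ n)) eq (gaps-≤ n xs))
  with k , refl ← ℕ.m≤n⇒∃[o]m+o≡n g≤n = begin
  filterᵇ p′ (upTo (suc (suc (g + k))))
    -- The cut lies just after `g`, so the second half consists of the successors of the old gaps
    -- from `g` on.
    ≡⟨ cong (filterᵇ p′) (trans (cong upTo (sym (ℕ.+-suc (suc g) k))) (applyUpTo-+ id (suc g) (suc k))) ⟩
  filterᵇ p′ (upTo (suc g) ++ applyUpTo (ℕ.suc ∘ (g +_)) (suc k))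
    ≡⟨ filterᵇ-++ p′ (upTo (suc g)) _ ⟩
  filterᵇ p′ (upTo (suc g)) ++ filterᵇ p′ (applyUpTo (ℕ.suc ∘ (g +_)) (suc k))
    ≡⟨ cong₂ _++_ lower upper ⟩
  filterᵇ (keep g xs) (ls ++ [ g ]) ++ map suc (filterᵇ (λ h → not (des h xs)) (g ∷ us)) ∎
  where
  p p′ : ℕ → Bool
  p  = good xs
  p′ = good (g ▹ xs)
  g-good : p g ≡ true
  g-good = cong not (All.head (proj₂ (All.++⁻ ls (subst (All (λ h → bad h xs ≡ false)) eq (gaps-good (g + k) xs)))))
  below above : List ℕ
  below = upTo g
  above = applyUpTo (g +_) (suc k)
  above≡ : filterᵇ p above ≡ g ∷ filterᵇ p (applyUpTo ((g +_) ∘ ℕ.suc) k)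
  above≡ rewrite ℕ.+-identityʳ g = filterᵇ-accept {p = p} g-good _
  -- Since the gaps are sorted, the occurrence of `g` identifies `ls` and `us` as the good gaps on
  -- its two sides.
  split : filterᵇ p below ≡ ls × filterᵇ p (applyUpTo ((g +_) ∘ ℕ.suc) k) ≡ us
  split = split-unique
    (All.filter⁺ (T? ∘ p) (All.applyUpTo⁺₁ id g id))
    (proj₁ (AllPairs-split ls (subst (AllPairs _<_) eq (gaps-< (g + k) xs))))
    (begin
      filterᵇ p below ++ g ∷ filterᵇ p (applyUpTo ((g +_) ∘ ℕ.suc) k)
        ≡⟨ cong (filterᵇ p below ++_) above≡ ⟨
      filterᵇ p below ++ filterᵇ p above
        ≡⟨ filterᵇ-++ p below above ⟨
      filterᵇ p (below ++ above)
        ≡⟨ cong (filterᵇ p) (trans (cong upTo (sym (ℕ.+-suc g k))) (applyUpTo-+ id g (suc k))) ⟨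
      gaps (g + k) xs
        ≡⟨ eq ⟩
      ls ++ g ∷ us ∎)
  lower : filterᵇ p′ (upTo (suc g)) ≡ filterᵇ (keep g xs) (ls ++ [ g ])
  lower = begin
    filterᵇ p′ (upTo (suc g))
      ≡⟨ filterᵇ-cong p′ (λ h → not ((inv h g xs ∨ asc h xs) ∨ bad h xs))
           (All.applyUpTo⁺₁ id (suc g) λ h<1+g → cong not (bad-lower (s≤s⁻¹ h<1+g) xs)) ⟩
    filterᵇ (λ h → not ((inv h g xs ∨ asc h xs) ∨ bad h xs)) (upTo (suc g))
      ≡⟨ filterᵇ-∨ (λ h → inv h g xs ∨ asc h xs) (λ h → bad h xs) (upTo (suc g)) ⟩
    filterᵇ (keep g xs) (filterᵇ p (upTo (suc g)))
      ≡⟨ cong (filterᵇ (keep g xs)) (begin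
           filterᵇ p (upTo (suc g))          ≡⟨ cong (filterᵇ p) (sym (upTo-∷ʳ g)) ⟩
           filterᵇ p (below ++ [ g ])        ≡⟨ filterᵇ-++ p below [ g ] ⟩
           filterᵇ p below ++ filterᵇ p [ g ] ≡⟨ cong₂ _++_ (proj₁ split) (filterᵇ-accept {p = p} g-good []) ⟩
           ls ++ [ g ] ∎) ⟩
    filterᵇ (keep g xs) (ls ++ [ g ]) ∎
  upper : filterᵇ p′ (applyUpTo (ℕ.suc ∘ (g +_)) (suc k)) ≡ map suc (filterᵇ (λ h → not (des h xs)) (g ∷ us))
  upper = begin
    filterᵇ p′ (applyUpTo (ℕ.suc ∘ (g +_)) (suc k))
      ≡⟨ cong (filterᵇ p′) (map-applyUpTo (g +_) ℕ.suc (suc k)) ⟨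
    filterᵇ p′ (map suc above)
      ≡⟨ filterᵇ-map p′ suc above ⟩
    map suc (filterᵇ (p′ ∘ ℕ.suc) above)
      ≡⟨ cong (map suc) (filterᵇ-cong (p′ ∘ ℕ.suc) (λ h → not (des h xs ∨ bad h xs))
           (All.applyUpTo⁺₂ (g +_) (suc k) λ i → cong not (bad-upper (ℕ.m≤m+n g i) xs))) ⟩
    map suc (filterᵇ (λ h → not (des h xs ∨ bad h xs)) above)
      ≡⟨ cong (map suc) (filterᵇ-∨ (λ h → des h xs) (λ h → bad h xs) above) ⟩
    map suc (filterᵇ (λ h → not (des h xs)) (filterᵇ p above))
      ≡⟨ cong (map ℕ.suc ∘ filterᵇ (λ h → not (des h xs))) (trans above≡ (cong (g ∷_) (proj₂ split))) ⟩
    map suc (filterᵇ (λ h → not (des h xs)) (g ∷ us)) ∎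

-- The four kinds of nodes of the generating tree

-- The number of nodes `m` levels below `xs` in the generating tree, where `n` is the length of
-- `xs`.
descendants : ℕ → ℕ → List ℕ → ℕ
descendants zero    n xs = 1
descendants (suc m) n xs = sum (map (λ g → descendants m (suc n) (g ▹ xs)) (gaps n xs))

-- The gap h ≤ g survives an insertion at g iff asc h and inv h g both fail, and
-- the gap h ≥ g iff des h fails.
module _ (n : ℕ) (xs : List ℕ) where

  -- Classified by the insertions a gap can survive: a `Low` gap those at or above it, keeping its
  -- lower copy; a `High` gap those at or below it, keeping its upper copy; a `Both` gap either
  -- kind.
  Low High Both : ℕ → Set
  Low  h = asc h xs ≡ false × des h xs ≡ true
  High h = asc h xs ≡ true  × des h xs ≡ false
  Both h = asc h xs ≡ false × des h xs ≡ false

  -- A value inserted at `k` on top of a descent between `h` and `k` forms the 432 of a 1432 whose 1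
  -- would go into gap `h`.
  Free Blocked : ℕ → ℕ → Set
  Free    h k = inv h k xs ≡ false
  Blocked h k = inv h k xs ≡ true

  -- In the tree these nodes are the increasing sequences: two gaps have no ascent below them, and
  -- no two gaps enclose a descent.
  record StateA (r : ℕ) : Set where
    constructor stateA
    field
      {x y}    : ℕ
      {highs}  : List ℕ
      complete : Complete n xs
      gaps≡    : gaps n xs ≡ x ∷ y ∷ highs
      length≡  : length highs ≡ r
      both     : Both x × Both y
      high     : All High highs
      free     : All (Free x) (y ∷ highs) × All (Free y) highs

  record StateB (r : ℕ) : Set where
    constructor stateB
    field
      {x y z}  : ℕ
      {highs}  : List ℕ
      complete : Complete n xs
      gaps≡    : gaps n xs ≡ x ∷ y ∷ z ∷ highs
      length≡  : length highs ≡ r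
      low      : Low x
      both     : Both y × Both z
      high     : All High highs
      free     : Free x y × All (Free y) (z ∷ highs) × All (Free z) highs
      blocked  : All (Blocked x) (z ∷ highs)

  -- Every high gap blocks every low one, so an insertion at a high gap removes all low gaps. This
  -- is why only the total number `k` matters.
  record StateC (k : ℕ) : Set where
    constructor stateC
    field
      {lows highs} : List ℕ
      complete     : Complete n xs
      gaps≡        : gaps n xs ≡ lows ++ highs
      length≡      : length lows + length highs ≡ k
      low          : All Low lows
      high         : All High highs
      free         : AllPairs Free lows
      blocked      : All (λ h → All (Blocked h) highs) lows

  record StateD (r : ℕ) : Set where
    constructor stateD
    field
      {x y}    : ℕ
      {highs}  : List ℕ
      complete : Complete n xs
      gaps≡    : gaps n xs ≡ x ∷ y ∷ highs
      length≡  : length highs ≡ r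
      low      : Low x
      high     : All High (y ∷ highs)
      free     : Free x y
      blocked  : All (Blocked x) highs

module _ {xs : List ℕ} where

  kept : ∀ {g h} → inv h g xs ≡ false → asc h xs ≡ false → keep g xs h ≡ true
  kept p q = cong₂ (λ u v → not (u ∨ v)) p q

  lost-inv : ∀ {g h} → inv h g xs ≡ true → keep g xs h ≡ false
  lost-inv {g} {h} p = cong (λ u → not (u ∨ asc h xs)) p

  lost-asc : ∀ {g h} → asc h xs ≡ true → keep g xs h ≡ false
  lost-asc {g} {h} p = trans (cong (λ u → not (inv h g xs ∨ u)) p) (cong not (∨-zeroʳ (inv h g xs)))

All-split : ∀ {P : ℕ → Set} {hs} ls {g us} → hs ≡ ls ++ g ∷ us → All P hs → All P ls × All P (g ∷ us)
All-split ls refl = All.++⁻ ls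

AllPairs-++⁻ˡ : ∀ {R : ℕ → ℕ → Set} xs {ys} → AllPairs R (xs ++ ys) → AllPairs R xs
AllPairs-++⁻ˡ []       _        = []
AllPairs-++⁻ˡ (x ∷ xs) (p ∷ ps) = proj₁ (All.++⁻ xs p) ∷ AllPairs-++⁻ˡ xs ps

AllPairs-map : ∀ {P : ℕ → Set} {R S : ℕ → ℕ → Set} → (∀ {x y} → P x → P y → R x y → S x y) →
               ∀ {xs} → All P xs → AllPairs R xs → AllPairs S xs
AllPairs-map f []       []       = []
AllPairs-map f (p ∷ ps) (r ∷ rs) = All.zipWith (λ (q , r) → f p q r) (ps , r) ∷ AllPairs-map f ps rs

-- Insertions that lead from one kind of node to another

module _ {n : ℕ} {xs : List ℕ} (complete : Complete n xs) where

  module Insert (ls : List ℕ) {g : ℕ} {us : List ℕ} (eq : gaps n xs ≡ ls ++ g ∷ us) where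

    ys : List ℕ
    ys = g ▹ xs

    private
      sorted : AllPairs _<_ (ls ++ g ∷ us)
      sorted = subst (AllPairs _<_) eq (gaps-< n xs)

    below : All (_< g) ls
    below = proj₁ (AllPairs-split ls sorted)

    above : All (g <_) us
    above = proj₂ (AllPairs-split ls sorted)

    bounded : All (_≤ n) (g ∷ us)
    bounded = proj₂ (All-split ls eq (gaps-≤ n xs))

    complete′ : Complete (suc n) ys
    complete′ = ▹-complete (All.head bounded) complete

    lower-low : ∀ {h} → asc h xs ≡ false → h < g → Low (suc n) ys h
    lower-low {h} p h<g = trans (asc-lower (ℕ.<⇒≤ h<g) xs) p ,
      trans (des-lower (ℕ.<⇒≤ h<g) xs)
        (cong (_∨ des h xs) (between-complete complete (All.head bounded) h<g))

    upper-high : ∀ {h} → asc h xs ≡ true → des h xs ≡ false → g ≤ h → High (suc n) ys (suc h)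
    upper-high {h} p q g≤h =
      trans (asc-upper g≤h xs) (trans (cong (between g h xs ∨_) p) (∨-zeroʳ _)) ,
      trans (des-upper g≤h xs) q

    upper-high′ : All (λ h → des h xs ≡ false) us → All (High (suc n) ys) (map suc us)
    upper-high′ ps = All.map⁺ (All.zipWith
      (λ {h} ((g<h , h≤n) , q) →
        trans (asc-upper (ℕ.<⇒≤ g<h) xs) (cong (_∨ asc h xs) (between-complete complete h≤n g<h)) ,
        trans (des-upper (ℕ.<⇒≤ g<h) xs) q)
      (All.zip (above , All.tail bounded) , ps))

    lower-free : ∀ {h k} → h ≤ g → k ≤ g → Free n xs h k → Free (suc n) ys h k
    lower-free h≤g k≤g = trans (inv-lower h≤g k≤g xs)

    upper-free : ∀ {h k} → g ≤ h → g ≤ k → Free n xs h k → Free (suc n) ys (suc h) (suc k)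
    upper-free g≤h g≤k = trans (inv-upper g≤h g≤k xs)

    across-free : ∀ {k} → g ≤ k → Free n xs g k → Free (suc n) ys g (suc k)
    across-free {k} g≤k p = trans (inv-across ℕ.≤-refl g≤k xs)
      (cong₂ _∨_ (between-refl g xs) p)

    -- The new entry `g` and the value `h`, present by completeness, form the blocking descent.
    across-blocked : ∀ {h k} → h < g → g ≤ k → Blocked (suc n) ys h (suc k)
    across-blocked {h} {k} h<g g≤k = trans (inv-across (ℕ.<⇒≤ h<g) g≤k xs)
      (cong (_∨ inv h k xs) (between-complete complete (All.head bounded) h<g))

    across-blocked′ : ∀ {h k} → h ≤ g → g ≤ k → Blocked n xs h k → Blocked (suc n) ys h (suc k)
    across-blocked′ {h} {k} h≤g g≤k p = trans (inv-across h≤g g≤k xs)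
      (trans (cong (between h g xs ∨_) p) (∨-zeroʳ _))

    both-lower : Both n xs g → Both (suc n) ys g
    both-lower (p , q) = trans (asc-lower ℕ.≤-refl xs) p ,
      trans (des-lower ℕ.≤-refl xs) (cong₂ _∨_ (between-refl g xs) q)

    both-upper : Both n xs g → Both (suc n) ys (suc g)
    both-upper (p , q) = trans (asc-upper ℕ.≤-refl xs) (cong₂ _∨_ (between-refl g xs) p) ,
      trans (des-upper ℕ.≤-refl xs) q

    gaps-ys : ∀ {ks vs} → filterᵇ (keep g xs) (ls ++ [ g ]) ≡ ks →
              filterᵇ (λ h → not (des h xs)) (g ∷ us) ≡ vs →
              gaps (suc n) ys ≡ ks ++ map suc vs
    gaps-ys refl refl = gaps-▹ {n} {xs} ls eq

  open Insert

  private
    ascents : ∀ {us} → All (λ h → des h xs ≡ false) us → filterᵇ (λ h → not (des h xs)) us ≡ us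
    ascents = filterᵇ-all ∘ All.map (cong not)

    keep-self : ∀ {g} → asc g xs ≡ false → keep g xs g ≡ true
    keep-self {g} = kept {xs} {g} {g} (inv-refl g xs)

  -- The gap `g` splits into two usable copies that keep its type, while all gaps above it acquire
  -- an ascent below them and become high.
  insert-both-least : ∀ {g us} → gaps n xs ≡ g ∷ us → Both n xs g →
    All (λ h → des h xs ≡ false) us → All (Free n xs g) us →
    StateA (suc n) (g ▹ xs) (length us)
  insert-both-least {g} {us} eq both@(p , q) des-us free = stateA
    (complete′ [] eq)
    (gaps-ys [] eq (filterᵇ-accept {p = keep g xs} (keep-self p) []) (ascents (q ∷ des-us)))
    (length-map suc us)
    (both-lower [] eq both , both-upper [] eq both)
    (upper-high′ [] eq des-us)
    ( across-free [] eq ℕ.≤-refl (inv-refl g xs)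
      ∷ All.map⁺ (All.zipWith (λ (g<h , f) → across-free [] eq (ℕ.<⇒≤ g<h) f) (above [] eq , free))
    , All.map⁺ (All.zipWith (λ (g<h , f) → upper-free [] eq ℕ.≤-refl (ℕ.<⇒≤ g<h) f) (above [] eq , free)))

  insert-both : ∀ ls {x g us} → gaps n xs ≡ ls ++ g ∷ us → Both n xs g →
    All (λ h → des h xs ≡ false) us → All (Free n xs g) us →
    filterᵇ (keep g xs) ls ≡ [ x ] → asc x xs ≡ false → Free n xs x g → x < g →
    StateB (suc n) (g ▹ xs) (length us)
  insert-both ls {x} {g} {us} eq both@(p , q) des-us free kept-ls asc-x free-x x<g = stateB
    (complete′ ls eq)
    (gaps-ys ls eq
      (trans (filterᵇ-++ (keep g xs) ls [ g ])
        (cong₂ _++_ kept-ls (filterᵇ-accept {p = keep g xs} (keep-self p) [])))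
      (ascents (q ∷ des-us)))
    (length-map suc us)
    (lower-low ls eq asc-x x<g)
    (both-lower ls eq both , both-upper ls eq both)
    (upper-high′ ls eq des-us)
    ( lower-free ls eq (ℕ.<⇒≤ x<g) ℕ.≤-refl free-x
    , across-free ls eq ℕ.≤-refl (inv-refl g xs)
      ∷ All.map⁺ (All.zipWith (λ (g<h , f) → across-free ls eq (ℕ.<⇒≤ g<h) f) (above ls eq , free))
    , All.map⁺ (All.zipWith (λ (g<h , f) → upper-free ls eq ℕ.≤-refl (ℕ.<⇒≤ g<h) f) (above ls eq , free)))
    ( across-blocked ls eq x<g ℕ.≤-refl
      ∷ All.map⁺ (All.map (λ g<h → across-blocked ls eq x<g (ℕ.<⇒≤ g<h)) (above ls eq)))

  -- The upper copy of `g` is lost to the descent above it; the lower copy stays low, and its free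
  -- and blocked relations carry over.
  insert-low-least : ∀ {g x us} → gaps n xs ≡ g ∷ x ∷ us → Low n xs g →
    All (λ h → des h xs ≡ false) (x ∷ us) → Free n xs g x → All (Blocked n xs g) us →
    StateD (suc n) (g ▹ xs) (length us)
  insert-low-least {g} {x} {us} eq (p , q) des-us free blocked = stateD
    (complete′ [] eq)
    (gaps-ys [] eq (filterᵇ-accept {p = keep g xs} (keep-self p) [])
      (trans (filterᵇ-reject {p = λ h → not (des h xs)} (cong not q) (x ∷ us)) (ascents des-us)))
    (length-map suc us)
    ( trans (asc-lower ℕ.≤-refl xs) p
    , trans (des-lower ℕ.≤-refl xs) (cong₂ _∨_ (between-refl g xs) q))
    (upper-high′ [] eq des-us)
    (across-free [] eq (ℕ.<⇒≤ (All.head (above [] eq))) free)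
    (All.map⁺ (All.zipWith (λ (g<h , b) → across-blocked′ [] eq ℕ.≤-refl (ℕ.<⇒≤ g<h) b)
      (All.tail (above [] eq) , blocked)))

  -- Only the upper copy of `g` survives, which accounts for `suc (length us)`. The survivors `ks`
  -- below become low and are blocked by everything above, because the new entry lies between.
  insert-high : ∀ ls {ks g us} → gaps n xs ≡ ls ++ g ∷ us → All (High n xs) (g ∷ us) →
    filterᵇ (keep g xs) ls ≡ ks → All (λ h → asc h xs ≡ false) ks → All (_< g) ks →
    AllPairs (Free n xs) ks →
    StateC (suc n) (g ▹ xs) (length ks + suc (length us))
  insert-high ls {ks} {g} {us} eq high kept-ls asc-ks ks<g free = stateC
    (complete′ ls eq)
    (gaps-ys ls eq
      (trans (filterᵇ-++ (keep g xs) ls [ g ])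
        (trans (cong₂ _++_ kept-ls (filterᵇ-reject {p = keep g xs}
                 (lost-asc {xs} {g} {g} (proj₁ (All.head high))) []))
          (++-identityʳ ks)))
      (ascents (All.map proj₂ high)))
    (cong (length ks +_) (length-map suc (g ∷ us)))
    (All.zipWith (λ (p , h<g) → lower-low ls eq p h<g) (asc-ks , ks<g))
    (All.map⁺ (All.zipWith (λ ((p , q) , g≤h) → upper-high ls eq p q g≤h) (high , g≤us)))
    (AllPairs-map (λ h<g k<g → lower-free ls eq (ℕ.<⇒≤ h<g) (ℕ.<⇒≤ k<g)) ks<g free)
    (All.map (λ h<g → All.map⁺ (All.map (across-blocked ls eq h<g) g≤us)) ks<g)
    where
    g≤us : All (g ≤_) (g ∷ us)
    g≤us = ℕ.≤-refl ∷ All.map ℕ.<⇒≤ (above ls eq)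

  -- The low gaps `ls′` and the upper copy of `g` have a descent above them and die; all high gaps
  -- survive.
  insert-low : ∀ ls {g ls′ highs} → gaps n xs ≡ (ls ++ g ∷ ls′) ++ highs →
    All (Low n xs) (ls ++ g ∷ ls′) → All (High n xs) highs → AllPairs (Free n xs) (ls ++ g ∷ ls′) →
    All (λ h → All (Blocked n xs h) highs) (ls ++ g ∷ ls′) →
    StateC (suc n) (g ▹ xs) (suc (length ls) + length highs)
  insert-low ls {g} {ls′} {highs} eq low high free blocked = stateC
    (complete′ ls eq′)
    (gaps-ys ls eq′
      (filterᵇ-all {p = keep g xs} (All.zipWith (λ { {h} ((p , _) , f) → kept {xs} {g} {h} f p })
        (low₁ , All.++⁺ (proj₁ (AllPairs-split ls free)) (inv-refl g xs ∷ []))))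
      (trans (filterᵇ-++ (λ h → not (des h xs)) (g ∷ ls′) highs)
        (cong₂ _++_ (filterᵇ-none (All.map (cong not ∘ proj₂) (proj₂ (All.++⁻ ls low))))
                    (ascents (All.map proj₂ high)))))
    (cong₂ _+_ (trans (length-++ ls) (ℕ.+-comm (length ls) 1)) (length-map suc highs))
    (All.zipWith (λ {h} ((p , q) , h≤g) → trans (asc-lower h≤g xs) p ,
        trans (des-lower h≤g xs) (trans (cong (between h g xs ∨_) q) (∨-zeroʳ _)))
      (low₁ , ls≤g))
    (All.map⁺ (All.zipWith (λ ((p , q) , g≤h) → upper-high ls eq′ p q g≤h) (high , g≤highs)))
    (AllPairs-map (lower-free ls eq′) ls≤g
      (AllPairs-++⁻ˡ (ls ++ [ g ]) (subst (AllPairs (Free n xs)) assoc free)))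
    (All.zipWith (λ (h≤g , bs) → All.map⁺ (All.zipWith (λ (b , g≤k) → across-blocked′ ls eq′ h≤g g≤k b)
        (bs , g≤highs)))
      (ls≤g , prefix blocked))
    where
    eq′ : gaps n xs ≡ ls ++ g ∷ (ls′ ++ highs)
    eq′ = trans eq (++-assoc ls (g ∷ ls′) highs)
    assoc : ls ++ g ∷ ls′ ≡ (ls ++ [ g ]) ++ ls′
    assoc = sym (++-assoc ls [ g ] ls′)
    prefix : ∀ {P : ℕ → Set} → All P (ls ++ g ∷ ls′) → All P (ls ++ [ g ])
    prefix {P} = proj₁ ∘ All.++⁻ (ls ++ [ g ]) ∘ subst (All P) assoc
    low₁ : All (Low n xs) (ls ++ [ g ])
    low₁ = prefix low
    ls≤g : All (_≤ g) (ls ++ [ g ])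
    ls≤g = All.++⁺ (All.map ℕ.<⇒≤ (below ls eq′)) (ℕ.≤-refl ∷ [])
    g≤highs : All (g ≤_) highs
    g≤highs = All.map ℕ.<⇒≤ (proj₂ (All.++⁻ ls′ (above ls eq′)))

-- Counting descendants

∑< : ℕ → (ℕ → ℕ) → ℕ
∑< zero    φ = 0
∑< (suc k) φ = φ k + ∑< k φ

∑<-head : ∀ k φ → ∑< (suc k) φ ≡ φ 0 + ∑< k (φ ∘ suc)
∑<-head zero    φ = refl
∑<-head (suc k) φ = begin
  φ (suc k) + ∑< (suc k) φ             ≡⟨ cong (φ (suc k) +_) (∑<-head k φ) ⟩
  φ (suc k) + (φ 0 + ∑< k (φ ∘ suc))   ≡⟨ ℕ.+-assoc (φ (suc k)) (φ 0) _ ⟨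
  (φ (suc k) + φ 0) + ∑< k (φ ∘ suc)   ≡⟨ cong (_+ ∑< k (φ ∘ suc)) (ℕ.+-comm (φ (suc k)) (φ 0)) ⟩
  (φ 0 + φ (suc k)) + ∑< k (φ ∘ suc)   ≡⟨ ℕ.+-assoc (φ 0) (φ (suc k)) _ ⟩
  φ 0 + (φ (suc k) + ∑< k (φ ∘ suc))   ∎
  where open ≡-Reasoning

∑<-+ : ∀ p q φ → ∑< (p + q) φ ≡ ∑< p (λ i → φ (i + q)) + ∑< q φ
∑<-+ zero    q φ = refl
∑<-+ (suc p) q φ = trans (cong (φ (p + q) +_) (∑<-+ p q φ)) (sym (ℕ.+-assoc (φ (p + q)) _ _))

sum-suffixes : ∀ {A : Set} {f : A → ℕ} {φ} hs → (∀ ls {g us} → hs ≡ ls ++ g ∷ us → f g ≡ φ (length us)) →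
               sum (map f hs) ≡ ∑< (length hs) φ
sum-suffixes []       eq = refl
sum-suffixes (h ∷ hs) eq = cong₂ _+_ (eq [] refl) (sum-suffixes hs λ ls → eq (h ∷ ls) ∘ cong (h ∷_))

sum-prefixes : ∀ {A : Set} {f : A → ℕ} {φ} hs → (∀ ls {g us} → hs ≡ ls ++ g ∷ us → f g ≡ φ (length ls)) →
               sum (map f hs) ≡ ∑< (length hs) φ
sum-prefixes []       eq = refl
sum-prefixes {φ = φ} (h ∷ hs) eq = trans
  (cong₂ _+_ (eq [] refl) (sum-prefixes {φ = φ ∘ suc} hs λ ls → eq (h ∷ ls) ∘ cong (h ∷_)))
  (sym (∑<-head (length hs) φ))

weightA weightB weightC weightD : ℕ → ℕ → ℕ
weightA zero    r = 1
weightA (suc m) r = weightA m (suc r) + (weightB m r + ∑< r (λ i → weightC m (3 + i)))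
weightB zero    r = 1
weightB (suc m) r = weightD m (suc r) + (weightB m (suc r) + (weightB m r + ∑< r (λ i → weightC m (3 + i))))
weightC zero    k = 1
weightC (suc m) k = ∑< k (λ i → weightC m (suc i))
weightD zero    r = 1
weightD (suc m) r = weightD m r + (weightC m (2 + r) + ∑< r (λ i → weightC m (suc i)))

module _ {n : ℕ} {xs : List ℕ} where

  descendants-suc : ∀ m {hs} → gaps n xs ≡ hs →
    descendants (suc m) n xs ≡ sum (map (λ g → descendants m (suc n) (g ▹ xs)) hs)
  descendants-suc m = cong (sum ∘ map (λ g → descendants m (suc n) (g ▹ xs)))

  -- Below an insertion at a high gap no high gap survives, since each has an
  -- ascent below it.
  high-step : ∀ m ls {ks highs} → Complete n xs → gaps n xs ≡ ls ++ highs → All (High n xs) highs →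
    (∀ {g} → All (_< g) ls → g ∈ highs →
       filterᵇ (keep g xs) ls ≡ ks × All (_< g) ks) →
    All (λ h → asc h xs ≡ false) ks → AllPairs (Free n xs) ks →
    (∀ {n xs k} → StateC n xs k → descendants m n xs ≡ weightC m k) →
    sum (map (λ g → descendants m (suc n) (g ▹ xs)) highs) ≡ ∑< (length highs) (λ i → weightC m (length ks + suc i))
  high-step m ls {ks} {highs} complete eq high kept asc-ks free countC = sum-suffixes highs λ ms {g} {us} split →
    let eq′ = trans eq (trans (cong (ls ++_) split) (sym (++-assoc ls ms (g ∷ us))))
        high-ms , high-us = All-split ms split high
        below = proj₁ (All.++⁻ ls (Insert.below complete (ls ++ ms) eq′))
        kept-ls , ks<g = kept below (subst (g ∈_) (sym split) (∈-++⁺ʳ ms (here refl)))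
    in countC (insert-high complete (ls ++ ms) eq′ high-us
         (trans (filterᵇ-++ (keep g xs) ls ms)
           (trans (cong₂ _++_ kept-ls (filterᵇ-none {p = keep g xs}
                    (All.map (λ {h} p → lost-asc {xs} {g} {h} (proj₁ p)) high-ms)))
             (++-identityʳ ks)))
         asc-ks ks<g free)

-- An insertion at a high gap leaves that gap and the high ones above it; at a low gap, it leaves
-- that gap, the low ones below it and all high ones. Together these sizes take each value from 1 to
-- `k` once.
countC : ∀ m {n xs k} → StateC n xs k → descendants m n xs ≡ weightC m k
countC zero    s = refl
countC (suc m) {n} {xs} (stateC {lows} {highs} complete gaps≡ refl low high free blocked) = begin
  descendants (suc m) n xs
    ≡⟨ descendants-suc {n} {xs} m gaps≡ ⟩
  sum (map child (lows ++ highs))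
    ≡⟨ trans (cong sum (map-++ child lows highs)) (sum-++ (map child lows) _) ⟩
  sum (map child lows) + sum (map child highs)
    ≡⟨ cong₂ _+_
         (sum-prefixes {f = child} {λ i → weightC m (suc i + length highs)} lows
           λ { ls {g} {us} refl → countC m (insert-low complete ls gaps≡ low high free blocked) })
         (high-step m lows complete gaps≡ high
           (λ {g} _ g∈ → filterᵇ-none {p = keep g xs}
             (All.map (λ {h} bs → lost-inv {xs} {g} {h} (All.lookup bs g∈)) blocked) , [])
           [] [] (countC m)) ⟩
  ∑< (length lows) (λ i → weightC m (suc i + length highs)) + ∑< (length highs) (λ i → weightC m (suc i))
    ≡⟨ ∑<-+ (length lows) (length highs) (weightC m ∘ suc) ⟨
  weightC (suc m) (length lows + length highs) ∎
  where
  child : ℕ → ℕ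
  child g = descendants m (suc n) (g ▹ xs)

countD : ∀ m {n xs r} → StateD n xs r → descendants m n xs ≡ weightD m r
countD zero    s = refl
countD (suc m) {n} {xs} (stateD {x} {y} {highs} complete gaps≡ refl low@(asc-x , _) (high-y ∷ high) free blocked) =
  trans (descendants-suc {n} {xs} m gaps≡) (cong₂ _+_
    (countD m (insert-low-least complete gaps≡ low (All.map proj₂ (high-y ∷ high)) free blocked))
    (cong₂ _+_
      (countC m (insert-high complete [ x ] gaps≡ (high-y ∷ high)
        (filterᵇ-accept {p = keep y xs} (kept {xs} {y} {x} free asc-x) [])
        (asc-x ∷ []) (Insert.below complete [ x ] gaps≡) ([] ∷ [])))
      (high-step m (x ∷ y ∷ []) complete gaps≡ high
        (λ {g} _ g∈ →
          trans (filterᵇ-reject {p = keep g xs} (lost-inv {xs} {g} {x} (All.lookup blocked g∈)) [ y ])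
            (filterᵇ-reject {p = keep g xs} (lost-asc {xs} {g} {y} (proj₁ high-y)) []) , [])
        [] [] (countC m))))

-- The gap `x` is blocked from `z` on, so inserting at `z` keeps only `y` below, and inserting at a
-- high gap keeps `y` and `z`. Those two survivors make the sizes of the C children start at 3.
countB : ∀ m {n xs r} → StateB n xs r → descendants m n xs ≡ weightB m r
countB zero    s = refl
countB (suc m) {n} {xs} (stateB {x} {y} {z} {highs} complete gaps≡ refl low@(asc-x , _)
    (both-y@(asc-y , des-y) , both-z@(asc-z , des-z)) high
    (free-xy , free-y@(free-yz ∷ free-yhs) , free-z) blocked@(blocked-xz ∷ blocked-x)) =
  trans (descendants-suc {n} {xs} m gaps≡) (cong₂ _+_
    (countD m (insert-low-least complete gaps≡ low (des-y ∷ des-z ∷ All.map proj₂ high) free-xy blocked))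
    (cong₂ _+_
      (countB m (insert-both complete [ x ] gaps≡ both-y (des-z ∷ All.map proj₂ high) free-y
        (filterᵇ-accept {p = keep y xs} (kept {xs} {y} {x} free-xy asc-x) [])
        asc-x free-xy (All.head (Insert.below complete [ x ] gaps≡))))
      (cong₂ _+_
        (countB m (insert-both complete (x ∷ y ∷ []) gaps≡ both-z (All.map proj₂ high) free-z
          (trans (filterᵇ-reject {p = keep z xs} (lost-inv {xs} {z} {x} blocked-xz) [ y ])
            (filterᵇ-accept {p = keep z xs} (kept {xs} {z} {y} free-yz asc-y) []))
          asc-y free-yz (All.head (All.tail (Insert.below complete (x ∷ y ∷ []) gaps≡)))))
        (high-step m (x ∷ y ∷ z ∷ []) complete gaps≡ high
          (λ { {g} (_ ∷ y<g ∷ z<g ∷ []) g∈ →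
            trans (filterᵇ-reject {p = keep g xs} (lost-inv {xs} {g} {x} (All.lookup blocked-x g∈)) (y ∷ z ∷ []))
            (filterᵇ-all {p = keep g xs}
              (kept {xs} {g} {y} (All.lookup free-yhs g∈) asc-y ∷ kept {xs} {g} {z} (All.lookup free-z g∈) asc-z ∷ []))
            , y<g ∷ z<g ∷ [] })
          (asc-y ∷ asc-z ∷ []) ((free-yz ∷ []) ∷ [] ∷ []) (countC m)))))

countA : ∀ m {n xs r} → StateA n xs r → descendants m n xs ≡ weightA m r
countA zero    s = refl
countA (suc m) {n} {xs} (stateA {x} {y} {highs} complete gaps≡ refl
    (both-x@(asc-x , des-x) , both-y@(asc-y , des-y)) high
    (free-x@(free-xy ∷ free-xhs) , free-y)) =
  trans (descendants-suc {n} {xs} m gaps≡) (cong₂ _+_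
    (countA m (insert-both-least complete gaps≡ both-x (des-y ∷ All.map proj₂ high) free-x))
    (cong₂ _+_
      (countB m (insert-both complete [ x ] gaps≡ both-y (All.map proj₂ high) free-y
        (filterᵇ-accept {p = keep y xs} (kept {xs} {y} {x} free-xy asc-x) [])
        asc-x free-xy (All.head (Insert.below complete [ x ] gaps≡))))
      (high-step m (x ∷ y ∷ []) complete gaps≡ high
        (λ { {g} (x<g ∷ y<g ∷ []) g∈ →
          filterᵇ-all {p = keep g xs}
            (kept {xs} {g} {x} (All.lookup free-xhs g∈) asc-x ∷ kept {xs} {g} {y} (All.lookup free-y g∈) asc-y ∷ [])
          , x<g ∷ y<g ∷ [] })
        (asc-x ∷ asc-y ∷ []) ((free-xy ∷ []) ∷ [] ∷ []) (countC m))))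

count-root : ∀ m → descendants (suc m) 0 [] ≡ weightA m 0
count-root m = trans (ℕ.+-identityʳ _)
  (countA m (insert-both-least {0} {[]} (λ ()) refl (refl , refl) [] []))

-- From permutations to sequences

Increasing : ∀ {n k} → Vec (Fin n) k → Set
Increasing p = ∀ a b → a Fin.< b → lookup p a Fin.< lookup p b

increasing-map-suc : ∀ {n k} (p : Vec (Fin n) k) → Increasing p → Increasing (Vec.map suc p)
increasing-map-suc p inc a b a<b =
  subst₂ Fin._<_ (sym (Vec.lookup-map a suc p)) (sym (Vec.lookup-map b suc p)) (s≤s (inc a b a<b))

increasing-zero-∷ : ∀ {n k} (p : Vec (Fin n) k) → Increasing p → Increasing (zero ∷ Vec.map suc p)
increasing-zero-∷ {n} p inc zero (suc b) _ = subst (zero {n} Fin.<_) (sym (Vec.lookup-map b suc p)) (s≤s z≤n)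
increasing-zero-∷ p inc (suc a) (suc b) (s≤s a<b) = increasing-map-suc p inc a b a<b

positive⇒map-suc : ∀ {n k} (p : Vec (Fin (suc n)) k) → (∀ a → zero {n} Fin.< lookup p a) →
                   ∃[ q ] p ≡ Vec.map suc q
positive⇒map-suc []            pos = [] , refl
positive⇒map-suc (zero ∷ p)    pos = contradiction (pos zero) λ ()
positive⇒map-suc (suc i ∷ p) pos with q , refl ← positive⇒map-suc p (pos ∘ suc) = i ∷ q , refl

increasing-map-suc⁻ : ∀ {n k} (p : Vec (Fin n) k) → Increasing (Vec.map suc p) → Increasing p
increasing-map-suc⁻ p inc a b a<b =
  ℕ.≤-pred (subst₂ Fin._<_ (Vec.lookup-map a suc p) (Vec.lookup-map b suc p) (inc a b a<b))

-- Increasing positions either begin with `zero` or are all positive, hence shifted positions of the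
-- tail; this mirrors the recursion of `some`.
some-tabulate : ∀ {n} k {P} (f : Fin n → ℕ) →
  T (some k P (tabulate f)) ⇔ (∃[ p ] Increasing p × T (P (Vec.map f p)))
some-tabulate zero f = mk⇔ (λ t → [] , (λ ()) , t) λ { ([] , _ , t) → t }
some-tabulate {zero} (suc k) f = mk⇔ (λ ()) λ { (() ∷ _ , _) }
some-tabulate {suc n} (suc k) {P} f = mk⇔
  ([ (λ t → let p , inc , t′ = to head t in
        zero ∷ Vec.map suc p , increasing-zero-∷ p inc ,
        subst (T ∘ P ∘ (f zero ∷_)) (Vec.map-∘ f suc p) t′)
   , (λ t → let p , inc , t′ = to tail t in
        Vec.map suc p , increasing-map-suc p inc , subst (T ∘ P) (Vec.map-∘ f suc p) t′)
   ]′ ∘ to T-∨)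
  (λ { (zero ∷ p , inc , t) → atZero p inc t ; (suc i ∷ p , inc , t) → atSuc i p inc t })
  where
  head : T (some k (P ∘ (f zero ∷_)) (tabulate (f ∘ suc))) ⇔ _
  head = some-tabulate k {P ∘ (f zero ∷_)} (f ∘ suc)
  tail : T (some (suc k) P (tabulate (f ∘ suc))) ⇔ _
  tail = some-tabulate (suc k) {P} (f ∘ suc)
  atZero : ∀ p → Increasing (zero ∷ p) → T (P (f zero ∷ Vec.map f p)) → T (some (suc k) P (tabulate f))
  atZero p inc t with q , refl ← positive⇒map-suc p (λ a → inc zero (suc a) (s≤s z≤n)) =
    from T-∨ (inj₁ (from head (q , increasing-map-suc⁻ q (λ a b → inc (suc a) (suc b) ∘ s≤s) ,
      subst (T ∘ P ∘ (f zero ∷_)) (sym (Vec.map-∘ f suc q)) t)))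
  atSuc : ∀ i p → Increasing (suc i ∷ p) → T (P (f (suc i) ∷ Vec.map f p)) → T (some (suc k) P (tabulate f))
  atSuc i p inc t with q , refl ← positive⇒map-suc p (λ a → ℕ.≤-trans (s≤s z≤n) (inc zero (suc a) (s≤s z≤n))) =
    from (T-∨ {some k (P ∘ (f zero ∷_)) (tabulate (f ∘ suc))})
      (inj₂ (from tail (i ∷ q , increasing-map-suc⁻ (i ∷ q) inc ,
        subst (T ∘ P) (sym (Vec.map-∘ f suc (i ∷ q))) t)))

-- Occurrences of the three patterns as chains of inequalities

Chain : Vec ℕ 4 → Set
Chain (x ∷ y ∷ z ∷ t ∷ []) = x < y × y < z × z < t

chain-mono : ∀ {xs} → Chain xs → ∀ i j → i Fin.< j → lookup xs i < lookup xs j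
chain-mono {_ ∷ _ ∷ _ ∷ _ ∷ []} (p , q , r) = λ where
  0F 1F _ → p
  0F 2F _ → ℕ.<-trans p q
  0F 3F _ → ℕ.<-trans p (ℕ.<-trans q r)
  1F 2F _ → q
  1F 3F _ → ℕ.<-trans q r
  2F 3F _ → r
  1F 1F (s≤s ())
  2F 1F (s≤s ())
  3F 1F (s≤s ())
  2F 2F (s≤s (s≤s ()))
  3F 2F (s≤s (s≤s ()))
  3F 3F (s≤s (s≤s (s≤s ())))

chain-reflect : ∀ {xs} → Chain xs → ∀ i j → lookup xs i < lookup xs j → i Fin.< j
chain-reflect chain i j xi<xj with Fin.<-cmp i j
... | tri< i<j _ _ = i<j
... | tri≈ _ refl _ = contradiction xi<xj (ℕ.<-irrefl refl)
... | tri> _ _ j<i = contradiction (chain-mono chain j i j<i) (ℕ.<-asym xi<xj)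

-- Pattern letters and values are both strictly increasing functions of the same rank, so they
-- compare alike.
chain⇒iso : ∀ {A : Set} {t w : A → ℕ} (rank : A → Fin 4) {xs} → Chain xs →
  (∀ a → t a ≡ suc (toℕ (rank a))) → (∀ a → w a ≡ lookup xs (rank a)) →
  ∀ a b → (t a < t b) ⇔ (w a < w b)
chain⇒iso rank chain t≡ w≡ a b = mk⇔
  (λ ta<tb → subst₂ _<_ (sym (w≡ a)) (sym (w≡ b))
    (chain-mono chain _ _ (ℕ.≤-pred (subst₂ _<_ (t≡ a) (t≡ b) ta<tb))))
  (λ wa<wb → subst₂ _<_ (sym (t≡ a)) (sym (t≡ b))
    (s≤s (chain-reflect chain _ _ (subst₂ _<_ (w≡ a) (w≡ b) wa<wb))))

p1432 p2143 p3412 : Vec ℕ 4 → Bool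
p1432 (a ∷ b ∷ c ∷ d ∷ []) = (a <ᵇ d) ∧ (d <ᵇ c) ∧ (c <ᵇ b)
p2143 (a ∷ b ∷ c ∷ d ∷ []) = (b <ᵇ a) ∧ (a <ᵇ d) ∧ (d <ᵇ c)
p3412 (a ∷ b ∷ c ∷ d ∷ []) = (a <ᵇ b) ∧ (c <ᵇ d) ∧ (d <ᵇ a)

full-split : ∀ xs → full xs ≡ some 4 p1432 xs ∨ some 4 p2143 xs ∨ some 4 p3412 xs
full-split xs = trans
  (some-cong 4 (λ { (a ∷ b ∷ c ∷ d ∷ []) → refl }) xs)
  (trans (some-∨ 4 p1432 (λ v → p2143 v ∨ p3412 v) xs)
    (cong (some 4 p1432 xs ∨_) (some-∨ 4 p2143 p3412 xs)))

<ᵇ-∧⇔ : ∀ {a b c d e f} → T ((a <ᵇ b) ∧ (c <ᵇ d) ∧ (e <ᵇ f)) ⇔ (a < b × c < d × e < f)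
<ᵇ-∧⇔ {a} {b} {c} {d} {e} {f} = mk⇔
  (λ t → let p , t′ = to T-∧ t ; q , r = to T-∧ t′ in <ᵇ⇒< a b p , <ᵇ⇒< c d q , <ᵇ⇒< e f r)
  (λ (p , q , r) → from T-∧ (<⇒<ᵇ p , from T-∧ (<⇒<ᵇ q , <⇒<ᵇ r)))

oneLine : ∀ {n} → Permutation′ n → List ℕ
oneLine π = tabulate (toℕ ∘ (π ⟨$⟩ʳ_))

rev : ∀ {n} → Permutation′ n → Permutation′ n
rev π = Perm.reverse ∘ₚ π

flip₄ : ∀ {A : Set} → Vec A 4 → Vec A 4
flip₄ (a ∷ b ∷ c ∷ d ∷ []) = d ∷ c ∷ b ∷ a ∷ []

increasing-flip : ∀ {n} (p : Vec (Fin n) 4) → Increasing p → Increasing (flip₄ (Vec.map opposite p))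
increasing-flip p@(i ∷ j ∷ k ∷ l ∷ []) inc a b a<b =
  subst₂ _<_ (Vec.lookup-map a toℕ p′) (Vec.lookup-map b toℕ p′)
    (chain-mono {Vec.map toℕ p′} (opposite-< k l (inc 2F 3F (<ᵇ⇒< 2 3 _)) ,
      opposite-< j k (inc 1F 2F (<ᵇ⇒< 1 2 _)) , opposite-< i j (inc 0F 1F (<ᵇ⇒< 0 1 _))) a b a<b)
  where
  p′ = flip₄ (Vec.map opposite p)
  opposite-< : ∀ x y → x Fin.< y → opposite y Fin.< opposite x
  opposite-< x y x<y = subst₂ _<_ (sym (Fin.opposite-prop y)) (sym (Fin.opposite-prop x))
    (ℕ.∸-monoʳ-< (s≤s x<y) (Fin.toℕ<n y))

module _ {n : ℕ} (π : Permutation′ n) where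

  private
    val : Fin n → ℕ
    val i = toℕ (π ⟨$⟩ʳ i)

  -- Replacing each position by its opposite and reversing the vector matches occurrences in `π`
  -- with subsequences of the reversed word; `flip₄` on the values makes up for the reading
  -- direction.
  Contains⇔some : ∀ {t₀ t₁ t₂ t₃ P} →
    (let τ = t₀ ∷ t₁ ∷ t₂ ∷ t₃ ∷ [] in
     (∀ w → T (P (flip₄ w)) ⇔ (∀ a b → (List.lookup τ a < List.lookup τ b) ⇔ (lookup w a < lookup w b))) →
     Contains π τ ⇔ T (some 4 P (oneLine (rev π))))
  Contains⇔some {t₀} {t₁} {t₂} {t₃} {P} P⇔ = mk⇔
    (λ (p , inc , iso) → from (some-tabulate 4 _)
      (flip₄ (Vec.map opposite p) , increasing-flip p inc ,
       subst (T ∘ P) (flip-val p) (from (P⇔ (Vec.map val p))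
         λ a b → subst₂ (λ x y → _ ⇔ (x < y)) (sym (Vec.lookup-map a val p)) (sym (Vec.lookup-map b val p)) (iso a b))))
    (λ t → let p , inc , t′ = to (some-tabulate 4 _) t in
       flip₄ (Vec.map opposite p) , increasing-flip p inc ,
       λ a b → subst₂ (λ x y → _ ⇔ (x < y))
         (Vec.lookup-map a val (flip₄ (Vec.map opposite p))) (Vec.lookup-map b val (flip₄ (Vec.map opposite p)))
         (to (P⇔ (Vec.map val (flip₄ (Vec.map opposite p)))) (subst (T ∘ P) (flip-flip p) t′) a b))
    where
    flip-val : ∀ p → flip₄ (Vec.map val p) ≡ Vec.map (val ∘ opposite) (flip₄ (Vec.map opposite p))
    flip-val (i ∷ j ∷ k ∷ l ∷ [])
      rewrite Fin.opposite-involutive i | Fin.opposite-involutive j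
            | Fin.opposite-involutive k | Fin.opposite-involutive l = refl
    flip-flip : ∀ p → Vec.map (val ∘ opposite) p ≡ flip₄ (Vec.map val (flip₄ (Vec.map opposite p)))
    flip-flip (i ∷ j ∷ k ∷ l ∷ []) = refl

T₃ : List Pattern
T₃ = (2 ∷ 1 ∷ 4 ∷ 3 ∷ []) ∷ (2 ∷ 3 ∷ 4 ∷ 1 ∷ []) ∷ (3 ∷ 4 ∷ 1 ∷ 2 ∷ []) ∷ []

private
  each : ∀ {Q : Fin 4 → Set} → Q 0F → Q 1F → Q 2F → Q 3F → ∀ a → Q a
  each q₀ q₁ q₂ q₃ = λ { 0F → q₀ ; 1F → q₁ ; 2F → q₂ ; 3F → q₃ }

module _ {n : ℕ} (π : Permutation′ n) where

  contains-2341 : Contains π (2 ∷ 3 ∷ 4 ∷ 1 ∷ []) ⇔ T (some 4 p1432 (oneLine (rev π)))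
  contains-2341 = Contains⇔some π λ { (d ∷ c ∷ b ∷ a ∷ []) → mk⇔
    -- The rank vector is the pattern 2341 with letters lowered by 1; the chain lists the values in
    -- increasing order.
    (λ t → chain⇒iso (lookup (1F ∷ 2F ∷ 3F ∷ 0F ∷ [])) {a ∷ d ∷ c ∷ b ∷ []} (to <ᵇ-∧⇔ t)
      (each refl refl refl refl) (each refl refl refl refl))
    (λ iso → from <ᵇ-∧⇔
      (to (iso 3F 0F) (<ᵇ⇒< 1 2 _) , to (iso 0F 1F) (<ᵇ⇒< 2 3 _) , to (iso 1F 2F) (<ᵇ⇒< 3 4 _))) }

  contains-3412 : Contains π (3 ∷ 4 ∷ 1 ∷ 2 ∷ []) ⇔ T (some 4 p2143 (oneLine (rev π)))
  contains-3412 = Contains⇔some π λ { (d ∷ c ∷ b ∷ a ∷ []) → mk⇔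
    (λ t → chain⇒iso (lookup (2F ∷ 3F ∷ 0F ∷ 1F ∷ [])) {b ∷ a ∷ d ∷ c ∷ []} (to <ᵇ-∧⇔ t)
      (each refl refl refl refl) (each refl refl refl refl))
    (λ iso → from <ᵇ-∧⇔
      (to (iso 2F 3F) (<ᵇ⇒< 1 2 _) , to (iso 3F 0F) (<ᵇ⇒< 2 3 _) , to (iso 0F 1F) (<ᵇ⇒< 3 4 _))) }

  contains-2143 : Contains π (2 ∷ 1 ∷ 4 ∷ 3 ∷ []) ⇔ T (some 4 p3412 (oneLine (rev π)))
  contains-2143 = Contains⇔some π λ { (d ∷ c ∷ b ∷ a ∷ []) → mk⇔
    -- The conjuncts of `p3412` are not in the order of the chain `c < d < a < b` and must be
    -- rearranged.
    (λ t → let a<b , c<d , d<a = to <ᵇ-∧⇔ t in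
      chain⇒iso (lookup (1F ∷ 0F ∷ 3F ∷ 2F ∷ [])) {c ∷ d ∷ a ∷ b ∷ []} (c<d , d<a , a<b)
      (each refl refl refl refl) (each refl refl refl refl))
    (λ iso → from <ᵇ-∧⇔
      (to (iso 3F 2F) (<ᵇ⇒< 3 4 _) , to (iso 1F 0F) (<ᵇ⇒< 1 2 _) , to (iso 0F 3F) (<ᵇ⇒< 2 3 _))) }

  avoids⇒ : Avoids π T₃ → T (not (full (oneLine (rev π))))
  avoids⇒ (¬2143 ∷ ¬2341 ∷ ¬3412 ∷ []) = subst (T ∘ not) (sym (full-split (oneLine (rev π))))
    (none _ _ _ (¬2341 ∘ from contains-2341) (¬3412 ∘ from contains-3412) (¬2143 ∘ from contains-2143))
    where
    none : ∀ x y z → ¬ T x → ¬ T y → ¬ T z → T (not (x ∨ y ∨ z))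
    none true  _     _     ¬x _  _  = ¬x _
    none false true  _     _  ¬y _  = ¬y _
    none false false true  _  _  ¬z = ¬z _
    none false false false _  _  _  = _

  avoids⇐ : T (not (full (oneLine (rev π)))) → Avoids π T₃
  avoids⇐ t =
    let ¬2341 , ¬3412 , ¬2143 = none _ _ _ (subst (T ∘ not) (full-split (oneLine (rev π))) t) in
    ¬2143 ∘ to contains-2143 ∷ ¬2341 ∘ to contains-2341 ∷ ¬3412 ∘ to contains-3412 ∷ []
    where
    none : ∀ x y z → T (not (x ∨ y ∨ z)) → ¬ T x × ¬ T y × ¬ T z
    none false false false _ = id , id , id

-- Summation over all permutations

sum-map-cong : ∀ {f g : A → ℕ} → f ≗ g → ∀ xs → sum (map f xs) ≡ sum (map g xs)
sum-map-cong f≗g xs = cong sum (map-cong f≗g xs)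

sum-map-0 : ∀ (xs : List A) → sum (map (λ _ → 0) xs) ≡ 0
sum-map-0 []       = refl
sum-map-0 (x ∷ xs) = sum-map-0 xs

sum-map-+ : ∀ (f g : A → ℕ) xs → sum (map (λ x → f x + g x) xs) ≡ sum (map f xs) + sum (map g xs)
sum-map-+ f g []       = refl
sum-map-+ f g (x ∷ xs) = begin
  (f x + g x) + sum (map (λ y → f y + g y) xs)        ≡⟨ cong (f x + g x +_) (sum-map-+ f g xs) ⟩
  (f x + g x) + (sum (map f xs) + sum (map g xs))     ≡⟨ ℕ.+-assoc (f x) (g x) _ ⟩
  f x + (g x + (sum (map f xs) + sum (map g xs)))     ≡⟨ cong (f x +_) (ℕ.+-comm (g x) _) ⟩
  f x + ((sum (map f xs) + sum (map g xs)) + g x)     ≡⟨ cong (f x +_) (ℕ.+-assoc (sum (map f xs)) _ _) ⟩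
  f x + (sum (map f xs) + (sum (map g xs) + g x))     ≡⟨ ℕ.+-assoc (f x) _ _ ⟨
  (f x + sum (map f xs)) + (sum (map g xs) + g x)     ≡⟨ cong (f x + sum (map f xs) +_) (ℕ.+-comm _ (g x)) ⟩
  (f x + sum (map f xs)) + (g x + sum (map g xs))     ∎
  where open ≡-Reasoning

sum-swap : ∀ (f : A → B → ℕ) xs ys →
  sum (map (λ x → sum (map (f x) ys)) xs) ≡ sum (map (λ y → sum (map (λ x → f x y) xs)) ys)
sum-swap f []       ys = sym (sum-map-0 ys)
sum-swap f (x ∷ xs) ys = trans (cong (sum (map (f x) ys) +_) (sum-swap f xs ys))
  (sym (sum-map-+ (f x) (λ y → sum (map (λ x → f x y) xs)) ys))

sum-cartesianProductWith : ∀ (f : C → ℕ) (g : A → B → C) xs ys →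
  sum (map f (cartesianProductWith g xs ys)) ≡ sum (map (λ x → sum (map (f ∘ g x) ys)) xs)
sum-cartesianProductWith f g []       ys = refl
sum-cartesianProductWith f g (x ∷ xs) ys = begin
  sum (map f (map (g x) ys ++ cartesianProductWith g xs ys))
    ≡⟨ cong sum (map-++ f (map (g x) ys) _) ⟩
  sum (map f (map (g x) ys) ++ map f (cartesianProductWith g xs ys))
    ≡⟨ sum-++ (map f (map (g x) ys)) _ ⟩
  sum (map f (map (g x) ys)) + sum (map f (cartesianProductWith g xs ys))
    ≡⟨ cong₂ _+_ (cong sum (sym (map-∘ ys))) (sum-cartesianProductWith f g xs ys) ⟩
  sum (map (f ∘ g x) ys) + sum (map (λ x → sum (map (f ∘ g x) ys)) xs) ∎
  where open ≡-Reasoning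

sum-filterᵇ : ∀ (f : A → ℕ) p xs →
  sum (map f (filterᵇ p xs)) ≡ sum (map (λ x → if p x then f x else 0) xs)
sum-filterᵇ f p [] = refl
sum-filterᵇ f p (x ∷ xs) with p x
... | true  = cong (f x +_) (sum-filterᵇ f p xs)
... | false = sum-filterᵇ f p xs

length-filterᵇ : ∀ (p : A → Bool) xs → length (filterᵇ p xs) ≡ sum (map (λ x → if p x then 1 else 0) xs)
length-filterᵇ p [] = refl
length-filterᵇ p (x ∷ xs) with p x
... | true  = cong suc (length-filterᵇ p xs)
... | false = length-filterᵇ p xs

tabulate-toℕ : ∀ (f : ℕ → A) n → tabulate {n = n} (f ∘ toℕ) ≡ applyUpTo f n
tabulate-toℕ f zero    = refl
tabulate-toℕ f (suc n) = cong (f 0 ∷_) (tabulate-toℕ (f ∘ suc) n)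

map-toℕ-allFin : ∀ n → map toℕ (allFin n) ≡ upTo n
map-toℕ-allFin n = trans (map-tabulate id toℕ) (tabulate-toℕ id n)

toℕ-punchIn : ∀ {n} (i : Fin (suc n)) j → toℕ (Fin.punchIn i j) ≡ bump (toℕ i) (toℕ j)
toℕ-punchIn zero    j       = refl
toℕ-punchIn (suc i) zero    = refl
toℕ-punchIn (suc i) (suc j) = cong suc (toℕ-punchIn i j)

oneLine-insert : ∀ {n} (g : Fin (suc n)) (π : Permutation′ n) →
                 oneLine (insert zero g π) ≡ toℕ g ▹ oneLine π
oneLine-insert g π = cong (toℕ g ∷_) (trans
  (tabulate-cong (λ i → toℕ-punchIn g (π ⟨$⟩ʳ i)))
  (sym (map-tabulate (toℕ ∘ (π ⟨$⟩ʳ_)) (bump (toℕ g)))))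

-- The value 0 on sequences containing a pattern allows sums over all permutations in place of sums
-- over the nodes of the tree.
weight : ℕ → ℕ → List ℕ → ℕ
weight m n xs = if not (full xs) then descendants m n xs else 0

weight-children : ∀ m n xs →
  sum (map (λ g → weight m (suc n) (g ▹ xs)) (upTo (suc n))) ≡ weight (suc m) n xs
weight-children m n xs with full xs in full≡
... | true  = trans
  (sum-map-cong (λ g → cong (λ b → if not b then descendants m (suc n) (g ▹ xs) else 0)
    (trans (full-▹ g xs) (trans (cong (bad g xs ∨_) full≡) (∨-zeroʳ _)))) (upTo (suc n)))
  (sum-map-0 (upTo (suc n)))
... | false = trans
  (sum-map-cong (λ g → cong (λ b → if not b then descendants m (suc n) (g ▹ xs) else 0)
    (trans (full-▹ g xs) (trans (cong (bad g xs ∨_) full≡) (∨-identityʳ _)))) (upTo (suc n)))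
  (sym (sum-filterᵇ (λ g → descendants m (suc n) (g ▹ xs)) (good xs) (upTo (suc n))))

-- The enumeration chooses the first value outermost, the tree chooses it last. Exchanging the two
-- sums moves one level from `n` to `m`.
sum-weight : ∀ n m → sum (map (weight m n ∘ oneLine) (permutations n)) ≡ descendants (n + m) 0 []
sum-weight zero    m = ℕ.+-identityʳ _
sum-weight (suc n) m = begin
  sum (map (weight m (suc n) ∘ oneLine) (permutations (suc n)))
    ≡⟨ sum-cartesianProductWith (weight m (suc n) ∘ oneLine) (insert zero) (allFin (suc n)) (permutations n) ⟩
  sum (map (λ g → sum (map (λ π → weight m (suc n) (oneLine (insert zero g π))) (permutations n))) (allFin (suc n)))
    ≡⟨ sum-swap (λ g π → weight m (suc n) (oneLine (insert zero g π))) (allFin (suc n)) (permutations n) ⟩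
  sum (map (λ π → sum (map (λ g → weight m (suc n) (oneLine (insert zero g π))) (allFin (suc n)))) (permutations n))
    ≡⟨ sum-map-cong children (permutations n) ⟩
  sum (map (weight (suc m) n ∘ oneLine) (permutations n))
    ≡⟨ sum-weight n (suc m) ⟩
  descendants (n + suc m) 0 []
    ≡⟨ cong (λ k → descendants k 0 []) (ℕ.+-suc n m) ⟩
  descendants (suc n + m) 0 [] ∎
  where
  children : ∀ π → sum (map (λ g → weight m (suc n) (oneLine (insert zero g π))) (allFin (suc n)))
             ≡ weight (suc m) n (oneLine π)
  children π = begin
    sum (map (λ g → weight m (suc n) (oneLine (insert zero g π))) (allFin (suc n)))
      ≡⟨ sum-map-cong (λ g → cong (weight m (suc n)) (oneLine-insert g π)) (allFin (suc n)) ⟩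
    sum (map (λ g → weight m (suc n) (toℕ g ▹ oneLine π)) (allFin (suc n)))
      ≡⟨ cong sum (map-∘ {g = λ g → weight m (suc n) (g ▹ oneLine π)} {f = toℕ} (allFin (suc n))) ⟩
    sum (map (λ g → weight m (suc n) (g ▹ oneLine π)) (map toℕ (allFin (suc n))))
      ≡⟨ cong (sum ∘ map (λ g → weight m (suc n) (g ▹ oneLine π))) (map-toℕ-allFin (suc n)) ⟩
    sum (map (λ g → weight m (suc n) (g ▹ oneLine π)) (upTo (suc n)))
      ≡⟨ weight-children m n (oneLine π) ⟩
    weight (suc m) n (oneLine π) ∎

-- Reversal permutes the one-line words

oneLine-cong : ∀ {n} {π ρ : Permutation′ n} → π Perm.≈ ρ → oneLine π ≡ oneLine ρ
oneLine-cong π≈ρ = tabulate-cong (cong toℕ ∘ π≈ρ)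

tabulate-injective : ∀ {n} {f g : Fin n → A} → tabulate f ≡ tabulate g → f ≗ g
tabulate-injective eq zero    = proj₁ (∷-injective eq)
tabulate-injective eq (suc i) = tabulate-injective (proj₂ (∷-injective eq)) i

oneLine-injective : ∀ {n} {π ρ : Permutation′ n} → oneLine π ≡ oneLine ρ → π Perm.≈ ρ
oneLine-injective eq = Fin.toℕ-injective ∘ tabulate-injective eq

rev-injective : ∀ {n} {π ρ : Permutation′ n} → rev π Perm.≈ rev ρ → π Perm.≈ ρ
rev-injective {π = π} {ρ} eq i = subst (λ j → π ⟨$⟩ʳ j ≡ ρ ⟨$⟩ʳ j) (Fin.opposite-involutive i) (eq (opposite i))

module _ (n : ℕ) where

  private
    ps : List (Permutation′ n)
    ps = permutations n

  oneLine-∈ : ∀ (π : Permutation′ n) → oneLine π ∈ map oneLine ps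
  oneLine-∈ π = Membership.∈-map⁺ (permutationSetoid n) (setoid (List ℕ)) {f = oneLine}
    (λ {π} {ρ} → oneLine-cong {n} {π} {ρ}) {v = π} (permutations-complete n π)

  oneLine-rev-∈ : ∀ (π : Permutation′ n) → oneLine π ∈ map (oneLine ∘ rev) ps
  oneLine-rev-∈ π = subst (_∈ map (oneLine ∘ rev) ps)
    (tabulate-cong (λ i → cong (toℕ ∘ (π ⟨$⟩ʳ_)) (Fin.opposite-involutive i)))
    (Membership.∈-map⁺ (permutationSetoid n) (setoid (List ℕ)) {f = oneLine ∘ rev}
      (λ {π} {ρ} π≈ρ → oneLine-cong {n} {rev π} {rev ρ} (π≈ρ ∘ opposite)) {v = rev π} (permutations-complete n (rev π)))

  -- Both lists are free of repetitions and have the same members. This turns counting permutations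
  -- with good reversals into counting good permutations.
  oneLine-rev-↭ : map (oneLine ∘ rev) ps ↭ map oneLine ps
  oneLine-rev-↭ = ∼bag⇒↭ (unique∧set⇒bag
    (Unique.map⁺ (permutationSetoid n) (setoid (List ℕ)) {f = oneLine ∘ rev}
      (λ {π} {ρ} eq → rev-injective {n} {π} {ρ} (oneLine-injective {n} {rev π} {rev ρ} eq)) (permutations-unique n))
    (Unique.map⁺ (permutationSetoid n) (setoid (List ℕ)) {f = oneLine}
      (λ {π} {ρ} → oneLine-injective {n} {π} {ρ}) (permutations-unique n))
    (mk⇔
      (λ x∈ → let π , _ , eq = ∈-map⁻ (oneLine ∘ rev) x∈ in subst (_∈ map oneLine ps) (sym eq) (oneLine-∈ (rev π)))
      (λ x∈ → let π , _ , eq = ∈-map⁻ oneLine x∈ in subst (_∈ map (oneLine ∘ rev) ps) (sym eq) (oneLine-rev-∈ π))))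

  length-S : length (S n T₃) ≡ descendants n 0 []
  length-S = begin
    length (filter (avoids? T₃) ps)
      ≡⟨ cong length (filter-≐ (avoids? T₃) (T? ∘ ok ∘ oneLine ∘ rev) ((λ {π} → avoids⇒ π) , (λ {π} → avoids⇐ π)) ps) ⟩
    length (filterᵇ (ok ∘ oneLine ∘ rev) ps)
      ≡⟨ length-map (oneLine ∘ rev) (filterᵇ (ok ∘ oneLine ∘ rev) ps) ⟨
    length (map (oneLine ∘ rev) (filterᵇ (ok ∘ oneLine ∘ rev) ps))
      ≡⟨ cong length (filterᵇ-map ok (oneLine ∘ rev) ps) ⟨
    length (filterᵇ ok (map (oneLine ∘ rev) ps))
      ≡⟨ ↭-length (filter-↭ (T? ∘ ok) oneLine-rev-↭) ⟩
    length (filterᵇ ok (map oneLine ps))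
      ≡⟨ length-filterᵇ ok (map oneLine ps) ⟩
    sum (map (weight 0 n) (map oneLine ps))
      ≡⟨ cong sum (map-∘ ps) ⟨
    sum (map (weight 0 n ∘ oneLine) ps)
      ≡⟨ sum-weight n 0 ⟩
    descendants (n + 0) 0 []
      ≡⟨ cong (λ k → descendants k 0 []) (ℕ.+-identityʳ n) ⟩
    descendants n 0 [] ∎
    where
    ok : List ℕ → Bool
    ok xs = not (full xs)

-- The closed form

-- The `k`-fold iterated partial sums of `s`, written so that Pascal's rule holds by definition.
table : (ℕ → ℕ) → ℕ → ℕ → ℕ
table s zero    m       = s m
table s (suc k) zero    = table s k zero
table s (suc k) (suc m) = table s k (suc m) + table s (suc k) m

table-zero : ∀ s k → table s k 0 ≡ s 0
table-zero s zero    = refl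
table-zero s (suc k) = table-zero s k

weightC-1 : ∀ m → weightC m 1 ≡ 1
weightC-1 zero    = refl
weightC-1 (suc m) = trans (ℕ.+-identityʳ _) (weightC-1 m)

weightC-2 : ∀ m → weightC m 2 ≡ suc m
weightC-2 zero    = refl
weightC-2 (suc m) = trans (cong₂ _+_ (weightC-2 m) (weightC-1 (suc m))) (ℕ.+-comm (suc m) 1)

-- The children `C 1` and `C 2`, absent from the rules for A and B, would contribute `1` and
-- `suc m`.
∑-weightC : ∀ m r → weightC (suc m) (2 + r) ≡ ∑< r (λ i → weightC m (3 + i)) + (2 + m)
∑-weightC m zero    = trans (weightC-2 (suc m)) refl
∑-weightC m (suc r) = trans (cong (weightC m (3 + r) +_) (∑-weightC m r)) (sym (ℕ.+-assoc (weightC m (3 + r)) _ _))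

-- weightD m (k - 1), extended to k = 0, where the induction of table-baseB
-- starts.
dTable : ℕ → ℕ → ℕ
dTable zero    k = 1
dTable (suc m) k = weightC m (2 + k) + weightC (suc m) k

dTable-suc : ∀ m k → dTable (suc m) (suc k) ≡ dTable m (suc k) + dTable (suc m) k
dTable-suc zero    k = refl
dTable-suc (suc m) k =
  lemma (weightC m (3 + k)) (weightC (suc m) (2 + k)) (weightC (suc m) (suc k)) (weightC (2 + m) k)
  where
  lemma : ∀ a b c d → (a + b) + (c + d) ≡ (a + c) + (b + d)
  lemma = ℕSolver.solve-∀

weightD≡ : ∀ m r → weightD m r ≡ dTable m (suc r)
weightD≡ zero    r = refl
weightD≡ (suc m) r = begin
  weightD m r + (weightC m (2 + r) + weightC (suc m) r)
    ≡⟨ cong (_+ (weightC m (2 + r) + weightC (suc m) r)) (weightD≡ m r) ⟩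
  dTable m (suc r) + dTable (suc m) r
    ≡⟨ dTable-suc m r ⟨
  dTable (suc m) (suc r) ∎

-- The initial columns that make table-baseB and table-baseA hold for k = 0.
baseB sumB baseA sumA : ℕ → ℕ
baseB zero    = 1
baseB (suc m) = dTable m 0 + (sumB m + baseB m)
sumB zero    = 1
sumB (suc m) = baseB (suc m) + sumB m
baseA zero    = 1
baseA (suc m) = sumA m + baseB m
sumA zero    = 1
sumA (suc m) = baseA (suc m) + sumA m

sumB≡table : ∀ m → sumB m ≡ table baseB 1 m
sumB≡table zero    = refl
sumB≡table (suc m) = cong (baseB (suc m) +_) (sumB≡table m)

sumA≡table : ∀ m → sumA m ≡ table baseA 1 m
sumA≡table zero    = refl
sumA≡table (suc m) = cong (baseA (suc m) +_) (sumA≡table m)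

-- Every term obeys Pascal's rule, so the identities at `(k , suc m)` and `(suc k , m)` add up to
-- the one at `(suc k , suc m)`. Column 0 holds by the choice of `baseB`.
table-baseB : ∀ k m → table baseB k (suc m) ≡
  dTable m k + (table baseB (suc k) m + (table baseB k m + weightC (suc m) k))
table-baseB zero m = cong (dTable m 0 +_) (cong₂ _+_ (sumB≡table m) (sym (ℕ.+-identityʳ (baseB m))))
table-baseB (suc k) zero = begin
  table baseB k 1 + table baseB k 0
    ≡⟨ cong (_+ table baseB k 0) (table-baseB k 0) ⟩
  1 + (table baseB k 0 + (table baseB k 0 + weightC 1 k)) + table baseB k 0
    ≡⟨ cong (λ z → 1 + (z + (z + weightC 1 k)) + z) (table-zero baseB k) ⟩
  1 + (1 + (1 + weightC 1 k)) + 1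
    ≡⟨ ℕ.+-comm _ 1 ⟩
  1 + (1 + (1 + (1 + weightC 1 k)))
    ≡⟨ cong (λ z → 1 + (z + (z + (1 + weightC 1 k)))) (table-zero baseB k) ⟨
  1 + (table baseB k 0 + (table baseB k 0 + (1 + weightC 1 k))) ∎
table-baseB (suc k) (suc m) = begin
  table baseB k (2 + m) + table baseB (suc k) (suc m)
    ≡⟨ cong₂ _+_ (table-baseB k (suc m)) (table-baseB (suc k) m) ⟩
  (dTable (suc m) k + (table baseB (suc k) (suc m) + (table baseB k (suc m) + weightC (2 + m) k))) +
  (dTable m (suc k) + (table baseB (2 + k) m + (table baseB (suc k) m + weightC (suc m) (suc k))))
    ≡⟨ lemma (dTable (suc m) k) (dTable m (suc k)) (table baseB k (suc m)) (table baseB (suc k) m)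
             (table baseB (2 + k) m) (weightC (2 + m) k) (weightC (suc m) (suc k)) ⟩
  (dTable m (suc k) + dTable (suc m) k) +
  (table baseB (2 + k) (suc m) + (table baseB (suc k) (suc m) + weightC (2 + m) (suc k)))
    ≡⟨ cong (_+ (table baseB (2 + k) (suc m) + (table baseB (suc k) (suc m) + weightC (2 + m) (suc k))))
         (dTable-suc m k) ⟨
  dTable (suc m) (suc k) + (table baseB (2 + k) (suc m) + (table baseB (suc k) (suc m) + weightC (2 + m) (suc k))) ∎
  where
  lemma : ∀ a b c d e f g →
    (a + ((c + d) + (c + f))) + (b + (e + (d + g))) ≡ (b + a) + (((c + d) + e) + ((c + d) + (g + f)))
  lemma = ℕSolver.solve-∀

table-baseA : ∀ k m → table baseA k (suc m) ≡ table baseA (suc k) m + (table baseB k m + weightC (suc m) k)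
table-baseA zero m = cong₂ _+_ (sumA≡table m) (sym (ℕ.+-identityʳ (baseB m)))
table-baseA (suc k) zero = begin
  table baseA k 1 + table baseA k 0
    ≡⟨ cong (_+ table baseA k 0) (table-baseA k 0) ⟩
  (table baseA k 0 + (table baseB k 0 + weightC 1 k)) + table baseA k 0
    ≡⟨ cong₂ (λ y z → (z + (y + weightC 1 k)) + z) (table-zero baseB k) (table-zero baseA k) ⟩
  (1 + (1 + weightC 1 k)) + 1
    ≡⟨ ℕ.+-comm _ 1 ⟩
  1 + (1 + (1 + weightC 1 k))
    ≡⟨ cong₂ (λ y z → z + (y + (1 + weightC 1 k))) (table-zero baseB k) (table-zero baseA k) ⟨
  table baseA k 0 + (table baseB k 0 + (1 + weightC 1 k)) ∎
table-baseA (suc k) (suc m) = begin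
  table baseA k (2 + m) + table baseA (suc k) (suc m)
    ≡⟨ cong₂ _+_ (table-baseA k (suc m)) (table-baseA (suc k) m) ⟩
  (table baseA (suc k) (suc m) + (table baseB k (suc m) + weightC (2 + m) k)) +
  (table baseA (2 + k) m + (table baseB (suc k) m + weightC (suc m) (suc k)))
    ≡⟨ lemma (table baseA (suc k) (suc m)) (table baseA (2 + k) m) (table baseB k (suc m)) (table baseB (suc k) m)
             (weightC (2 + m) k) (weightC (suc m) (suc k)) ⟩
  table baseA (2 + k) (suc m) + (table baseB (suc k) (suc m) + weightC (2 + m) (suc k)) ∎
  where
  lemma : ∀ a b c d e f → (a + (c + e)) + (b + (d + f)) ≡ (a + b) + ((c + d) + (f + e))
  lemma = ℕSolver.solve-∀

-- The summand `2 + m` supplies the missing C children. The doubling serves two children: A and B in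
-- the rule for A, the two B nodes in the rule for B; the D child needs no correction.
offset : ℕ → ℕ
offset zero    = 0
offset (suc m) = offset m + offset m + (2 + m)

weightB≡ : ∀ m r → weightB m r + offset m ≡ table baseB (2 + r) m
weightB≡ zero    r = sym (table-zero baseB r)
weightB≡ (suc m) r = begin
  (weightD m (suc r) + (weightB m (suc r) + (weightB m r + ∑< r _))) + (offset m + offset m + (2 + m))
    ≡⟨ lemma (weightD m (suc r)) (weightB m (suc r)) (weightB m r) _ (offset m) (2 + m) ⟩
  weightD m (suc r) + ((weightB m (suc r) + offset m) + ((weightB m r + offset m) + (∑< r _ + (2 + m))))
    ≡⟨ cong₂ _+_ (weightD≡ m (suc r)) (cong₂ _+_ (weightB≡ m (suc r))
         (cong₂ _+_ (weightB≡ m r) (sym (∑-weightC m r)))) ⟩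
  dTable m (2 + r) + (table baseB (3 + r) m + (table baseB (2 + r) m + weightC (suc m) (2 + r)))
    ≡⟨ table-baseB (2 + r) m ⟨
  table baseB (2 + r) (suc m) ∎
  where
  lemma : ∀ a b c d e f → (a + (b + (c + d))) + (e + e + f) ≡ a + ((b + e) + ((c + e) + (d + f)))
  lemma = ℕSolver.solve-∀

weightA≡ : ∀ m r → weightA m r + offset m ≡ table baseA (2 + r) m
weightA≡ zero    r = sym (table-zero baseA r)
weightA≡ (suc m) r = begin
  (weightA m (suc r) + (weightB m r + ∑< r _)) + (offset m + offset m + (2 + m))
    ≡⟨ lemma (weightA m (suc r)) (weightB m r) _ (offset m) (2 + m) ⟩
  (weightA m (suc r) + offset m) + ((weightB m r + offset m) + (∑< r _ + (2 + m)))
    ≡⟨ cong₂ _+_ (weightA≡ m (suc r)) (cong₂ _+_ (weightB≡ m r) (sym (∑-weightC m r))) ⟩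
  table baseA (3 + r) m + (table baseB (2 + r) m + weightC (suc m) (2 + r))
    ≡⟨ table-baseA (2 + r) m ⟨
  table baseA (2 + r) (suc m) ∎
  where
  lemma : ∀ a c d e f → (a + (c + d)) + (e + e + f) ≡ (a + e) + ((c + e) + (d + f))
  lemma = ℕSolver.solve-∀

-- `ψ n` is the increment of `φ` at `n`. The matrix of the step has trace 3 and determinant 1. The
-- initial values continue the values 4 and 5, forced at index 1, backwards to index 0.
φ ψ : ℕ → ℕ
φ zero    = 3
φ (suc n) = φ n + ψ n
ψ zero    = 1
ψ (suc n) = φ n + 2 ℕ.* ψ n

mutual
  -- The corrections `1` and, for `sumB`, `suc m` absorb the inhomogeneous term `dTable (suc m) 0`,
  -- which is `suc m`. Indices start at 1 because `dTable 0 0` is 1 and not 0.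
  baseB≡φ : ∀ m → baseB (suc m) + 1 ≡ φ (suc m)
  baseB≡φ zero    = refl
  baseB≡φ (suc m) = begin
    ((weightC m 2 + 0) + (sumB (suc m) + baseB (suc m))) + 1
      ≡⟨ cong (λ z → ((z + 0) + (sumB (suc m) + baseB (suc m))) + 1) (weightC-2 m) ⟩
    ((suc m + 0) + (sumB (suc m) + baseB (suc m))) + 1
      ≡⟨ lemma m (sumB (suc m)) (baseB (suc m)) ⟩
    (baseB (suc m) + 1) + (sumB (suc m) + suc m)
      ≡⟨ cong₂ _+_ (baseB≡φ m) (sumB≡ψ m) ⟩
    φ (2 + m) ∎
    where
    lemma : ∀ m a b → ((suc m + 0) + (a + b)) + 1 ≡ (b + 1) + (a + suc m)
    lemma = ℕSolver.solve-∀

  sumB≡ψ : ∀ m → sumB (suc m) + suc m ≡ ψ (suc m)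
  sumB≡ψ zero    = refl
  sumB≡ψ (suc m) = begin
    (baseB (2 + m) + sumB (suc m)) + (2 + m)
      ≡⟨ lemma m (baseB (2 + m)) (sumB (suc m)) ⟩
    (baseB (2 + m) + 1) + (sumB (suc m) + suc m)
      ≡⟨ cong₂ _+_ (baseB≡φ (suc m)) (sumB≡ψ m) ⟩
    (φ (suc m) + ψ (suc m)) + ψ (suc m)
      ≡⟨ lemma′ (φ (suc m)) (ψ (suc m)) ⟩
    ψ (2 + m) ∎
    where
    lemma : ∀ m a b → (a + b) + (2 + m) ≡ (a + 1) + (b + suc m)
    lemma = ℕSolver.solve-∀
    lemma′ : ∀ a b → (a + b) + b ≡ a + 2 ℕ.* b
    lemma′ = ℕSolver.solve-∀

-- Each step doubles `sumA` and adds an entry of `baseB`, hence the power of 2.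
sumA≡ψ : ∀ m → sumA (suc m) + 3 ℕ.* 2 ℕ.^ m ≡ ψ (suc m) + 1
sumA≡ψ zero    = refl
-- The extra 1 is the one that `baseB≡φ` needs next to `baseB`.
sumA≡ψ (suc m) = ℕ.+-cancelʳ-≡ 1 _ _ (begin
  ((sumA (suc m) + baseB (suc m)) + sumA (suc m)) + 3 ℕ.* (2 ℕ.* 2 ℕ.^ m) + 1
    ≡⟨ lemma (sumA (suc m)) (baseB (suc m)) (2 ℕ.^ m) ⟩
  2 ℕ.* (sumA (suc m) + 3 ℕ.* 2 ℕ.^ m) + (baseB (suc m) + 1)
    ≡⟨ cong₂ (λ y z → 2 ℕ.* y + z) (sumA≡ψ m) (baseB≡φ m) ⟩
  2 ℕ.* (ψ (suc m) + 1) + φ (suc m)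
    ≡⟨ lemma′ (φ (suc m)) (ψ (suc m)) ⟩
  ψ (2 + m) + 1 + 1 ∎)
  where
  lemma : ∀ a b c → ((a + b) + a) + 3 ℕ.* (2 ℕ.* c) + 1 ≡ 2 ℕ.* (a + 3 ℕ.* c) + (b + 1)
  lemma = ℕSolver.solve-∀
  lemma′ : ∀ a b → 2 ℕ.* (b + 1) + a ≡ (a + 2 ℕ.* b) + 1 + 1
  lemma′ = ℕSolver.solve-∀

-- Summing `sumA≡ψ` telescopes, since `ψ` is the increment of `φ`.
table-baseA-2 : ∀ m → table baseA 2 m + 3 ℕ.* 2 ℕ.^ m ≡ φ (suc m) + m
table-baseA-2 zero    = refl
table-baseA-2 (suc m) = begin
  (table baseA 1 (suc m) + table baseA 2 m) + 3 ℕ.* (2 ℕ.* 2 ℕ.^ m)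
    ≡⟨ cong (λ z → (z + table baseA 2 m) + 3 ℕ.* (2 ℕ.* 2 ℕ.^ m)) (sym (sumA≡table (suc m))) ⟩
  (sumA (suc m) + table baseA 2 m) + 3 ℕ.* (2 ℕ.* 2 ℕ.^ m)
    ≡⟨ lemma (sumA (suc m)) (table baseA 2 m) (2 ℕ.^ m) ⟩
  (table baseA 2 m + 3 ℕ.* 2 ℕ.^ m) + (sumA (suc m) + 3 ℕ.* 2 ℕ.^ m)
    ≡⟨ cong₂ _+_ (table-baseA-2 m) (sumA≡ψ m) ⟩
  (φ (suc m) + m) + (ψ (suc m) + 1)
    ≡⟨ lemma′ (φ (suc m)) (ψ (suc m)) m ⟩
  (φ (suc m) + ψ (suc m)) + suc m ∎
  where
  lemma : ∀ a b c → (a + b) + 3 ℕ.* (2 ℕ.* c) ≡ (b + 3 ℕ.* c) + (a + 3 ℕ.* c)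
  lemma = ℕSolver.solve-∀
  lemma′ : ∀ a b m → (a + m) + (b + 1) ≡ (a + b) + suc m
  lemma′ = ℕSolver.solve-∀

offset≡ : ∀ m → offset m + m + 3 ≡ 3 ℕ.* 2 ℕ.^ m
offset≡ zero    = refl
offset≡ (suc m) = begin
  (offset m + offset m + (2 + m)) + suc m + 3 ≡⟨ lemma (offset m) m ⟩
  2 ℕ.* (offset m + m + 3)                 ≡⟨ cong (2 ℕ.*_) (offset≡ m) ⟩
  2 ℕ.* (3 ℕ.* 2 ℕ.^ m)                   ≡⟨ lemma′ (2 ℕ.^ m) ⟩
  3 ℕ.* (2 ℕ.* 2 ℕ.^ m)                   ∎
  where
  lemma : ∀ a m → (a + a + (2 + m)) + suc m + 3 ≡ 2 ℕ.* (a + m + 3)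
  lemma = ℕSolver.solve-∀
  lemma′ : ∀ a → 2 ℕ.* (3 ℕ.* a) ≡ 3 ℕ.* (2 ℕ.* a)
  lemma′ = ℕSolver.solve-∀

weightA-closed : ∀ m → weightA m 0 + 3 ℕ.* 2 ℕ.^ suc m ≡ φ (suc m) + 2 ℕ.* suc m + 1
weightA-closed m = begin
  weightA m 0 + 3 ℕ.* (2 ℕ.* 2 ℕ.^ m)
    ≡⟨ cong (weightA m 0 +_) (lemma (2 ℕ.^ m)) ⟩
  weightA m 0 + (3 ℕ.* 2 ℕ.^ m + 3 ℕ.* 2 ℕ.^ m)
    ≡⟨ cong (λ z → weightA m 0 + (z + 3 ℕ.* 2 ℕ.^ m)) (sym (offset≡ m)) ⟩
  weightA m 0 + (offset m + m + 3 + 3 ℕ.* 2 ℕ.^ m)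
    ≡⟨ lemma′ (weightA m 0) (offset m) m (3 ℕ.* 2 ℕ.^ m) ⟩
  (weightA m 0 + offset m) + 3 ℕ.* 2 ℕ.^ m + (m + 3)
    ≡⟨ cong (λ z → z + 3 ℕ.* 2 ℕ.^ m + (m + 3)) (weightA≡ m 0) ⟩
  table baseA 2 m + 3 ℕ.* 2 ℕ.^ m + (m + 3)
    ≡⟨ cong (_+ (m + 3)) (table-baseA-2 m) ⟩
  φ (suc m) + m + (m + 3)
    ≡⟨ lemma″ (φ (suc m)) m ⟩
  φ (suc m) + 2 ℕ.* suc m + 1 ∎
  where
  lemma : ∀ a → 3 ℕ.* (2 ℕ.* a) ≡ 3 ℕ.* a + 3 ℕ.* a
  lemma = ℕSolver.solve-∀
  lemma′ : ∀ a b m c → a + (b + m + 3 + c) ≡ (a + b) + c + (m + 3)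
  lemma′ = ℕSolver.solve-∀
  lemma″ : ∀ a m → a + m + (m + 3) ≡ a + 2 ℕ.* suc m + 1
  lemma″ = ℕSolver.solve-∀

-- The generating function

open import Data.Integer.Base using (+_; -_)

*-cong : ∀ {f f′ g g′} → f ≈ f′ → g ≈ g′ → f * g ≈ f′ * g′
*-cong f≈ g≈ zero    = cong₂ (λ x y → x ℤ.* y ℤ.+ 0ℤ) (f≈ 0) (g≈ 0)
*-cong f≈ g≈ (suc n) = cong₂ ℤ._+_ (cong₂ ℤ._*_ (f≈ 0) (g≈ (suc n))) (*-cong (f≈ ∘ suc) g≈ n)

-- The product unfolds along its left factor; this is the mirror image that commutativity requires.
*-suc : ∀ f g n → (f * g) (suc n) ≡ g 0 ℤ.* f (suc n) ℤ.+ (f * (g ∘ suc)) n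
*-suc f g zero = lemma (f 0) (f 1) (g 0) (g 1)
  where
  lemma : ∀ a b c d → a ℤ.* d ℤ.+ (b ℤ.* c ℤ.+ 0ℤ) ≡ c ℤ.* b ℤ.+ (a ℤ.* d ℤ.+ 0ℤ)
  lemma = solve-∀
*-suc f g (suc n) = trans
  (cong (λ z → f 0 ℤ.* g (2 ℕ.+ n) ℤ.+ z) (*-suc (f ∘ suc) g n))
  (lemma (f 0 ℤ.* g (2 ℕ.+ n)) (g 0 ℤ.* f (2 ℕ.+ n)) _)
  where
  lemma : ∀ a b c → a ℤ.+ (b ℤ.+ c) ≡ b ℤ.+ (a ℤ.+ c)
  lemma = solve-∀

*-comm : ∀ f g → f * g ≈ g * f
*-comm f g zero    = cong (ℤ._+ 0ℤ) (ℤ.*-comm (f 0) (g 0))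
*-comm f g (suc n) = trans (*-suc f g n) (cong (λ z → g 0 ℤ.* f (suc n) ℤ.+ z) (*-comm f (g ∘ suc) n))

*-zeroˡ : ∀ {f} g → (∀ n → f n ≡ 0ℤ) → ∀ n → (f * g) n ≡ 0ℤ
*-zeroˡ g f≡0 zero    = trans (cong (λ x → x ℤ.* g 0 ℤ.+ 0ℤ) (f≡0 0)) refl
*-zeroˡ g f≡0 (suc n) = trans
  (cong₂ (λ x y → x ℤ.* g (suc n) ℤ.+ y) (f≡0 0) (*-zeroˡ g (f≡0 ∘ suc) n)) refl

constant-* : ∀ f g → (∀ n → f (suc n) ≡ 0ℤ) → ∀ n → (f * g) n ≡ f 0 ℤ.* g n
constant-* f g f≡0 zero    = ℤ.+-identityʳ _
constant-* f g f≡0 (suc n) = trans (cong (λ z → f 0 ℤ.* g (suc n) ℤ.+ z) (*-zeroˡ g f≡0 n)) (ℤ.+-identityʳ _)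

Degree≤ : ℕ → Series → Set
Degree≤ k f = ∀ n → f (suc k ℕ.+ n) ≡ 0ℤ

*-degree : ∀ {f g} k l → Degree≤ k f → Degree≤ l g → Degree≤ (k ℕ.+ l) (f * g)
*-degree {f} {g} zero l f≡0 g≡0 n = trans (constant-* f g f≡0 (suc l ℕ.+ n))
  (trans (cong (f 0 ℤ.*_) (g≡0 n)) (ℤ.*-zeroʳ (f 0)))
*-degree {f} {g} (suc k) l f≡0 g≡0 n = trans
  (cong₂ (λ x y → f 0 ℤ.* x ℤ.+ y)
    (trans (cong g (lemma k l n)) (g≡0 (suc k ℕ.+ n))) (*-degree {f ∘ suc} {g} k l f≡0 g≡0 n))
  (trans (ℤ.+-identityʳ _) (ℤ.*-zeroʳ (f 0)))
  where
  lemma : ∀ k l n → suc (suc k ℕ.+ l ℕ.+ n) ≡ suc l ℕ.+ (suc k ℕ.+ n)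
  lemma = ℕSolver.solve-∀

numerator denominator : Series
numerator   = polynomial (+ 1 ∷ - + 6 ∷ + 13 ∷ - + 11 ∷ + 5 ∷ [])
denominator = polynomial (+ 1 ∷ - + 1 ∷ []) ^ 2 * polynomial (+ 1 ∷ - + 2 ∷ [])
            * polynomial (+ 1 ∷ - + 3 ∷ + 1 ∷ [])

-- A product does not evaluate at a symbolic index but its polynomial factors do, so the bound is
-- assembled from their degrees.
denominator-degree : Degree≤ 5 denominator
denominator-degree =
  *-degree {f²*} {c} 3 2
    (*-degree {a ^ 2} {b} 2 1
      (*-degree {a} {a ^ 1} 1 1 (λ _ → refl) (*-degree {a} {a ^ 0} 1 0 (λ _ → refl) (λ _ → refl)))
      (λ _ → refl))
    (λ _ → refl)
  where
  a b c f²* : Series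
  a = polynomial (+ 1 ∷ - + 1 ∷ [])
  b = polynomial (+ 1 ∷ - + 2 ∷ [])
  c = polynomial (+ 1 ∷ - + 3 ∷ + 1 ∷ [])
  f²* = a ^ 2 * b

closed : Series
closed n = + φ n ℤ.+ + 2 ℤ.* + n ℤ.+ + 1 ℤ.- + 3 ℤ.* + (2 ℕ.^ n)

F≈closed : F T₃ ≈ closed
-- The root belongs to none of the four families, so size 0 is checked by evaluation.
F≈closed zero    = refl
F≈closed (suc m) = begin
  + length (S (suc m) T₃)
    ≡⟨ cong +_ (trans (length-S (suc m)) (count-root m)) ⟩
  + weightA m 0
    ≡⟨ cancel (+ weightA m 0) (+ (3 ℕ.* 2 ℕ.^ suc m)) ⟩
  + (weightA m 0 ℕ.+ 3 ℕ.* 2 ℕ.^ suc m) ℤ.- + (3 ℕ.* 2 ℕ.^ suc m)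
    ≡⟨ cong₂ ℤ._-_ (cong +_ (weightA-closed m)) (ℤ.pos-* 3 (2 ℕ.^ suc m)) ⟩
  + φ (suc m) ℤ.+ + (2 ℕ.* suc m) ℤ.+ + 1 ℤ.- + 3 ℤ.* + (2 ℕ.^ suc m)
    ≡⟨ cong (λ z → + φ (suc m) ℤ.+ z ℤ.+ + 1 ℤ.- + 3 ℤ.* + (2 ℕ.^ suc m)) (ℤ.pos-* 2 (suc m)) ⟩
  closed (suc m) ∎
  where
  cancel : ∀ x y → x ≡ (x ℤ.+ y) ℤ.- y
  cancel = solve-∀

-- Powers of the matrix of the linear recurrence of (φ , ψ).
α β α′ β′ : ℕ → ℕ
α  zero    = 1
α  (suc k) = α k ℕ.+ α′ k
β  zero    = 0
β  (suc k) = β k ℕ.+ β′ k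
α′ zero    = 0
α′ (suc k) = α k ℕ.+ 2 ℕ.* α′ k
β′ zero    = 1
β′ (suc k) = β k ℕ.+ 2 ℕ.* β′ k

φ-+ : ∀ k n → φ (k ℕ.+ n) ≡ α k ℕ.* φ n ℕ.+ β k ℕ.* ψ n
ψ-+ : ∀ k n → ψ (k ℕ.+ n) ≡ α′ k ℕ.* φ n ℕ.+ β′ k ℕ.* ψ n
φ-+ zero    n = lemma (φ n)
  where
  lemma : ∀ x → x ≡ (x ℕ.+ 0) ℕ.+ 0
  lemma = ℕSolver.solve-∀
φ-+ (suc k) n = trans (cong₂ ℕ._+_ (φ-+ k n) (ψ-+ k n)) (lemma (α k) (α′ k) (β k) (β′ k) (φ n) (ψ n))
  where
  lemma : ∀ a a′ b b′ x y →
    (a ℕ.* x ℕ.+ b ℕ.* y) ℕ.+ (a′ ℕ.* x ℕ.+ b′ ℕ.* y) ≡ (a ℕ.+ a′) ℕ.* x ℕ.+ (b ℕ.+ b′) ℕ.* y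
  lemma = ℕSolver.solve-∀
ψ-+ zero    n = sym (ℕ.+-identityʳ (ψ n))
ψ-+ (suc k) n = trans (cong₂ (λ x y → x ℕ.+ 2 ℕ.* y) (φ-+ k n) (ψ-+ k n))
  (lemma (α k) (α′ k) (β k) (β′ k) (φ n) (ψ n))
  where
  lemma : ∀ a a′ b b′ x y →
    (a ℕ.* x ℕ.+ b ℕ.* y) ℕ.+ 2 ℕ.* (a′ ℕ.* x ℕ.+ b′ ℕ.* y) ≡
    (a ℕ.+ 2 ℕ.* a′) ℕ.* x ℕ.+ (b ℕ.+ 2 ℕ.* b′) ℕ.* y
  lemma = ℕSolver.solve-∀

-- Expresses all shifts through the same four quantities, which the ring solver can treat as
-- unknowns.
closed-+ : ∀ k n → closed (k ℕ.+ n) ≡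
  + α k ℤ.* + φ n ℤ.+ + β k ℤ.* + ψ n ℤ.+ + 2 ℤ.* (+ k ℤ.+ + n) ℤ.+ + 1 ℤ.- + 3 ℤ.* (+ (2 ℕ.^ k) ℤ.* + (2 ℕ.^ n))
closed-+ k n = cong₂ (λ x y → x ℤ.+ + 2 ℤ.* (+ k ℤ.+ + n) ℤ.+ + 1 ℤ.- + 3 ℤ.* y)
  (trans (cong +_ (φ-+ k n)) (cong₂ ℤ._+_ (ℤ.pos-* (α k) (φ n)) (ℤ.pos-* (β k) (ψ n))))
  (trans (cong +_ (ℕ.^-distribˡ-+-* 2 k n)) (ℤ.pos-* (2 ℕ.^ k) (2 ℕ.^ n)))

closed-* : closed * denominator ≈ numerator
closed-* 0 = refl
closed-* 1 = refl
closed-* 2 = refl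
closed-* 3 = refl
closed-* 4 = refl
closed-* (suc (suc (suc (suc (suc n))))) = begin
  (closed * denominator) (5 ℕ.+ n)
    ≡⟨ *-comm closed denominator (5 ℕ.+ n) ⟩
  -- The denominator expands to `1 - 7x + 18x² - 21x³ + 11x⁴ - 2x⁵`. With it on the left, five terms
  -- unfold, and what remains of it is the constant `-2`.
  + 1 ℤ.* closed (5 ℕ.+ n) ℤ.+ (- + 7 ℤ.* closed (4 ℕ.+ n) ℤ.+ (+ 18 ℤ.* closed (3 ℕ.+ n) ℤ.+
  (- + 21 ℤ.* closed (2 ℕ.+ n) ℤ.+ (+ 11 ℤ.* closed (1 ℕ.+ n) ℤ.+
  (denominator ∘ (5 ℕ.+_) * closed) n))))
    ≡⟨ cong₂ (λ x y → + 1 ℤ.* x ℤ.+ y) (closed-+ 5 n) (cong₂ (λ x y → - + 7 ℤ.* x ℤ.+ y) (closed-+ 4 n)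
       (cong₂ (λ x y → + 18 ℤ.* x ℤ.+ y) (closed-+ 3 n) (cong₂ (λ x y → - + 21 ℤ.* x ℤ.+ y) (closed-+ 2 n)
       (cong₂ (λ x y → + 11 ℤ.* x ℤ.+ y) (closed-+ 1 n)
       (constant-* (denominator ∘ (5 ℕ.+_)) closed denominator-degree n))))) ⟩
  _
    ≡⟨ vanish (+ φ n) (+ ψ n) (+ n) (+ (2 ℕ.^ n)) ⟩
  0ℤ ∎
  where
  vanish : ∀ x y m w →
    -- The coefficients of `x` and `y` are `α k` and `β k`, consecutive Fibonacci numbers.
    + 1 ℤ.* (+ 34 ℤ.* x ℤ.+ + 55 ℤ.* y ℤ.+ + 2 ℤ.* (+ 5 ℤ.+ m) ℤ.+ + 1 ℤ.- + 3 ℤ.* (+ 32 ℤ.* w)) ℤ.+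
    (- + 7 ℤ.* (+ 13 ℤ.* x ℤ.+ + 21 ℤ.* y ℤ.+ + 2 ℤ.* (+ 4 ℤ.+ m) ℤ.+ + 1 ℤ.- + 3 ℤ.* (+ 16 ℤ.* w)) ℤ.+
    (+ 18 ℤ.* (+ 5 ℤ.* x ℤ.+ + 8 ℤ.* y ℤ.+ + 2 ℤ.* (+ 3 ℤ.+ m) ℤ.+ + 1 ℤ.- + 3 ℤ.* (+ 8 ℤ.* w)) ℤ.+
    (- + 21 ℤ.* (+ 2 ℤ.* x ℤ.+ + 3 ℤ.* y ℤ.+ + 2 ℤ.* (+ 2 ℤ.+ m) ℤ.+ + 1 ℤ.- + 3 ℤ.* (+ 4 ℤ.* w)) ℤ.+
    (+ 11 ℤ.* (+ 1 ℤ.* x ℤ.+ + 1 ℤ.* y ℤ.+ + 2 ℤ.* (+ 1 ℤ.+ m) ℤ.+ + 1 ℤ.- + 3 ℤ.* (+ 2 ℤ.* w)) ℤ.+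
    - + 2 ℤ.* (x ℤ.+ + 2 ℤ.* m ℤ.+ + 1 ℤ.- + 3 ℤ.* w))))) ≡ 0ℤ
  vanish = solve-∀

theorem3 : F ((2 ∷ 1 ∷ 4 ∷ 3 ∷ []) ∷ (2 ∷ 3 ∷ 4 ∷ 1 ∷ []) ∷ (3 ∷ 4 ∷ 1 ∷ 2 ∷ []) ∷ [])
    ≈ polynomial (+ 1 ∷ - + 6 ∷ + 13 ∷ - + 11 ∷ + 5 ∷ [])
    / (polynomial (+ 1 ∷ - + 1 ∷ []) ^ 2
    * polynomial (+ 1 ∷ - + 2 ∷ [])
    * polynomial (+ 1 ∷ - + 3 ∷ + 1 ∷ []))
theorem3 n = trans (F≈closed n) (/-unique closed numerator denominator closed-* n)
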